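{- Let $\Gamma$ be a graph and $C=\{v_1,\dots,v_8\}$ a subset of $8$ of its vertices, identified with the eight points of the affine space $\mathrm{AG}(3,2)$, i.e. the vertices of a cube, by $v_1=000$, $v_2=111$, $v_3=101$, $v_4=010$, $v_5=110$, $v_6=001$, $v_7=011$, $v_8=100$. Suppose that: (i) The induced subgraph on $C$ is one of the $40$ graphs $B_1,\dots,B_{40}$ listed in the context. (ii) For every vertex $v$ outside $C$, the set of neighbours of $v$ in $C$ is either $C$, or $\emptyset$, or a set of four vertices forming an affine plane of $\mathrm{AG}(3,2)$. Let $\pi$ be an automorphism of the cube of order six (in other words, a "rotation + complementation"; up to an automorphism of the switching set $C$, the choice of $\pi$ does not matter). Construct $\Gamma'$ from $\Gamma$ on the same vertex set as follows, leaving all other adjacencies unchanged. For every $v$ outside $C$ whose neighbourhood in $C$ is an affine plane $S$, change its neighbourhood in $C$ to: - $\pi(S)$, if $S$ is a face of the cube; - $C\setminus S$, if $S$ is a plane connecting two opposite edges of the cube; - $S$ itself, if $S$ is a set of four pairwise non-adjacent vertices of the cube. If the induced subgraph on $C$ is one of $B_6,\dots,B_{40}$, with adjacency matrix $B$ with respect to the order $v_1,\dots,v_8$, replace it by the graph with adjacency matrix $R_{\mathrm{cube}}^TBR_{\mathrm{cube}}$. Then $\Gamma'$ is $\mathbb{R}$-cospectral with $\Gamma$.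
   Context: Graphs are simple and loopless. Two graphs with adjacency matrices $A$ and $A'$ are $\mathbb{R}$-cospectral if $A+rJ$ and $A'+rJ$ have the same spectrum for every $r\in\mathbb{R}$, where $J$ is the all-ones matrix. The cube has vertex set $\mathbb{F}_2^3$ (written as binary words), two vertices being adjacent when they differ in exactly one coordinate. The 14 affine planes of $\mathrm{AG}(3,2)$ are: the 6 faces of the cube; the 6 planes connecting two opposite edges; and the 2 sets of four pairwise non-adjacent vertices. An automorphism of the cube of order six is an order-three rotation composed with complementation (the antipodal map). $$R_{\mathrm{cube}}=\frac12\begin{bmatrix} -I&I&I&I \\ I&-Z&I&Z \\ I&Z&-Z&I \\ I&I&Z&-Z \end{bmatrix}$$ where $I$, $J$ and $Z=J-I$ are here square matrices of order $2$ ($I$ the identity, $J$ all-ones). The 40 graphs on $\{v_1,\dots,v_8\}$, given by their edges ("$ij$" stands for $v_iv_j$): $B_1$: no edges. $B_2$ (the cube): 14 16 18 23 25 27 36 38 45 47 58 67. $B_3$: 12 34 56 78. $B_4$: 17 18 27 28 35 36 45 46. $B_5$: 12 17 18 27 28 34 35 36 45 46 56 78. $B_6$: 25 26 27 36 38 45 47 48 67 78. $B_7$: 24 25 27 34 36 38 45 48 56 78. $B_8$: 24 25 26 27 34 36 38 45 46 48 67 78. $B_9$: 23 25 27 34 56 78. $B_{10}$: 23 25 27 28 34 38 56 68. $B_{11}$: 23 25 26 27 28 34 38 46 67 68. $B_{12}$: 23 24 25 26 27 28 38 45 46 48 67 68. $B_{13}$: 17 27 28 35 36 38 45 46 58 78.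 $B_{14}$: 17 26 28 35 45 46 47 48 56 67. $B_{15}$: 17 26 27 28 35 38 45 46 56 58 68 78. $B_{16}$: 17 24 25 27 34 36 38 45 47 48 56 57. $B_{17}$: 17 24 25 26 27 34 36 38 45 46 47 48 57 67. $B_{18}$: 17 23 27 28 34 36 37 38 45 46 58 78. $B_{19}$: 17 23 26 28 34 37 45 46 47 48 56 67. $B_{20}$: 17 23 26 27 34 45 46 47 56 57 58 67. $B_{21}$: 17 23 26 27 28 34 37 38 45 46 56 58 68 78. $B_{22}$: 17 23 24 25 37 38 45 47 56 58 68 78. $B_{23}$: 17 23 24 25 27 45 47 48 56 57. $B_{24}$: 17 23 24 25 26 37 38 45 46 47 58 67 68 78. $B_{25}$: 17 23 24 25 26 27 45 46 47 48 57 67. $B_{26}$: 17 23 24 25 26 27 37 38 45 46 58 68. $B_{27}$: 17 23 24 25 26 27 28 37 38 45 46 48 68 78. $B_{28}$: 17 18 24 25 34 36 37 38 45 47 56 68. $B_{29}$: 17 18 24 25 27 34 36 38 45 47 56 57 68 78. $B_{30}$: 17 18 24 25 26 34 36 37 38 45 46 47 67 68. $B_{31}$: 17 18 23 26 28 34 37 45 46 47 56 67 68 78. $B_{32}$: 17 18 23 26 27 28 34 37 45 46 56 68. $B_{33}$: 17 18 23 24 25 37 45 47 56 68. $B_{34}$: 17 18 23 24 25 26 37 45 46 47 67 68. $B_{35}$: 15 18 24 26 34 45 47 48 57 67 68 78. $B_{36}$: 15 18 24 26 27 34 45 48 57 68. $B_{37}$: 15 18 24 25 34 35 36 45 47 48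 67 78. $B_{38}$: 15 18 24 25 28 34 35 36 38 45 47 48 67 68. $B_{39}$: 15 17 18 23 26 27 28 34 35 37 45 46 58 68. $B_{40}$: 14 16 17 23 25 28 35 38 46 47 58 67.
   Formalization: For B_6,…,B_40, π must be the order-six automorphism that R_cube^T realises on faces (xyz ↦ complement of yzx); with the fixed R_cube the claim fails for other π (e.g. K_5∪K_4 with B_40 and the inverse of this π). All order-six automorphisms are proved conjugate. -}

module Defs where

open import Algebra.Bundles using (CommutativeRing)
open import Algebra.Structures using (IsCommutativeRing)
import Algebra.Properties.Monoid.Sum as MonoidSum
open import Data.Bool.Base using (Bool; true; false; not; _∨_; _xor_; if_then_else_)
open import Data.Bool.ListAction using (any)
open import Data.Fin.Base using (Fin; toℕ; remQuot)
import Data.Fin.Properties as Fin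
open import Data.Fin.Permutation using (Permutation′; _⟨$⟩ʳ_; _⟨$⟩ˡ_)
open import Data.Fin.Subset using (Subset; _∈_; ⊤; ⊥; ∁; ∣_∣)
open import Data.List.Base using (List; []; _∷_)
open import Data.Nat.Base as ℕ using (ℕ; suc; _⊔_)
open import Data.Nat.GeneralisedArithmetic using (fold)
import Data.Nat.Properties as ℕ
open import Data.Product.Base using (_×_; _,_; ∃; ∃-syntax; ∃₂; proj₁; proj₂)
import Data.Rational.Base as ℚ
open ℚ using (ℚ; 0ℚ; 1ℚ; ½; positive)
import Data.Rational.Properties as ℚ
open import Data.Sum.Base using (_⊎_)
open import Data.Vec.Base using (Vec; []; _∷_; lookup; tabulate; map; zipWith; replicate)
open import Function.Base using (_∘_)
open import Function.Bundles using (_⇔_)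
open import Level using (0ℓ)
open import Relation.Binary.PropositionalEquality.Core
  using (_≡_; _≢_; refl; sym; trans; cong; cong₂; subst)
open import Relation.Nullary using (¬_; does)

-- The real numbers, as Cauchy sequences of rationals

-- f m n → 0 as m, n → ∞
Null : (ℕ → ℕ → ℚ) → Set
Null f = ∀ ε → 0ℚ ℚ.< ε →
         ∃[ N ] (∀ m n → N ℕ.≤ m → N ℕ.≤ n → ℚ.∣ f m n ∣ ℚ.< ε)

record ℝ : Set where
  constructor mkℝ
  field
    seq    : ℕ → ℚ
    cauchy : Null (λ m n → seq m ℚ.- seq n)

open ℝ public

infix 4 _≈ℝ_

-- For Cauchy sequences this is equivalent to seq x n - seq y n → 0.
_≈ℝ_ : ℝ → ℝ → Set
x ≈ℝ y = Null (λ m n → seq x m ℚ.- seq y n)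

private
  module Identities (K : CommutativeRing 0ℓ 0ℓ) where
    open CommutativeRing K renaming (sym to ≈-sym; trans to ≈-trans)
    open import Algebra.Properties.AbelianGroup +-abelianGroup
      using (⁻¹-anti-homo‿-; ⁻¹-∙-comm; //-rightDividesˡ)
    open import Algebra.Properties.Ring ring using (x[y-z]≈xy-xz)
    open import Algebra.Properties.CommutativeSemigroup +-commutativeSemigroup
      using (interchange)
    open import Relation.Binary.Reasoning.Setoid setoid

    cancel : ∀ a b → (a - b) + b ≈ a
    cancel a b = //-rightDividesˡ b a

    telescope : ∀ a b c → (a - b) + (b - c) ≈ a - c
    telescope a b c = ≈-trans (≈-sym (+-assoc (a - b) b (- c))) (+-congʳ (cancel a b))

    neg-difference : ∀ a b → - (a - b) ≈ b - a
    neg-difference = ⁻¹-anti-homo‿-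

    difference-neg : ∀ a b → - (a - b) ≈ - a - - b
    difference-neg a b = ≈-sym (⁻¹-∙-comm a (- b))

    difference-+ : ∀ a b c d → (a - b) + (c - d) ≈ (a + c) - (b + d)
    difference-+ a b c d =
      ≈-trans (interchange a (- b) c (- d)) (+-congˡ (⁻¹-∙-comm b d))

    difference-* : ∀ a b c d → a * (c - d) + d * (a - b) ≈ a * c - b * d
    difference-* a b c d = begin
      a * (c - d) + d * (a - b)
        ≈⟨ +-cong (x[y-z]≈xy-xz a c d) (x[y-z]≈xy-xz d a b) ⟩
      (a * c - a * d) + (d * a - d * b)
        ≈⟨ +-congˡ (+-cong (*-comm d a) (-‿cong (*-comm d b))) ⟩
      (a * c - a * d) + (a * d - b * d)
        ≈⟨ telescope (a * c) (a * d) (b * d) ⟩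
      a * c - b * d ∎

  open Identities ℚ.+-*-commutativeRing

  Null-cong : ∀ {f g} → (∀ m n → f m n ≡ g m n) → Null f → Null g
  Null-cong f≗g F ε 0<ε with F ε 0<ε
  ... | N , bound = N , λ m n N≤m N≤n →
    subst (λ q → ℚ.∣ q ∣ ℚ.< ε) (f≗g m n) (bound m n N≤m N≤n)

  Null-swap : ∀ {f} → Null f → Null (λ m n → f n m)
  Null-swap F ε 0<ε with F ε 0<ε
  ... | N , bound = N , λ m n N≤m N≤n → bound n m N≤n N≤m

  Null-diagonal : ∀ {f} → Null f → Null (λ m n → f n n)
  Null-diagonal F ε 0<ε with F ε 0<ε
  ... | N , bound = N , λ m n N≤m N≤n → bound n n N≤n N≤n

  Null-neg : ∀ {f} → Null f → Null (λ m n → ℚ.- f m n)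
  Null-neg {f} F ε 0<ε with F ε 0<ε
  ... | N , bound = N , λ m n N≤m N≤n →
    subst (ℚ._< ε) (sym (ℚ.∣-p∣≡∣p∣ (f m n))) (bound m n N≤m N≤n)

  Null-+ : ∀ {f g} → Null f → Null g → Null (λ m n → f m n ℚ.+ g m n)
  Null-+ {f} {g} F G ε 0<ε
    with F (½ ℚ.* ε) 0<½ε | G (½ ℚ.* ε) 0<½ε
    where
    0<½ε : 0ℚ ℚ.< ½ ℚ.* ε
    0<½ε = subst (ℚ._< ½ ℚ.* ε) (ℚ.*-zeroʳ ½) (ℚ.*-monoʳ-<-pos ½ 0<ε)
  ... | M , boundF | N , boundG = M ⊔ N , λ m n p q →
    ℚ.≤-<-trans (ℚ.∣p+q∣≤∣p∣+∣q∣ (f m n) (g m n))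
      (subst (ℚ.∣ f m n ∣ ℚ.+ ℚ.∣ g m n ∣ ℚ.<_) halves
        (ℚ.+-mono-<
          (boundF m n (ℕ.m⊔n≤o⇒m≤o M N p) (ℕ.m⊔n≤o⇒m≤o M N q))
          (boundG m n (ℕ.m⊔n≤o⇒n≤o M N p) (ℕ.m⊔n≤o⇒n≤o M N q))))
    where
    halves : ½ ℚ.* ε ℚ.+ ½ ℚ.* ε ≡ ε
    halves = trans (sym (ℚ.*-distribʳ-+ ε ½ ½)) (ℚ.*-identityˡ ε)

  eventually-bounded : ∀ x → ∃₂ λ N b → 0ℚ ℚ.< b × (∀ n → N ℕ.≤ n → ℚ.∣ seq x n ∣ ℚ.< b)
  eventually-bounded x with cauchy x 1ℚ (ℚ.positive⁻¹ 1ℚ)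
  ... | N , bound = N , b , 0<b , below
    where
    b : ℚ
    b = 1ℚ ℚ.+ ℚ.∣ seq x N ∣

    0<b : 0ℚ ℚ.< b
    0<b = ℚ.+-mono-<-≤ (ℚ.positive⁻¹ 1ℚ) (ℚ.0≤∣p∣ (seq x N))

    below : ∀ n → N ℕ.≤ n → ℚ.∣ seq x n ∣ ℚ.< b
    below n N≤n = ℚ.≤-<-trans
      (subst (λ q → ℚ.∣ q ∣ ℚ.≤ ℚ.∣ seq x n ℚ.- seq x N ∣ ℚ.+ ℚ.∣ seq x N ∣)
        (cancel (seq x n) (seq x N))
        (ℚ.∣p+q∣≤∣p∣+∣q∣ (seq x n ℚ.- seq x N) (seq x N)))
      (ℚ.+-monoˡ-< ℚ.∣ seq x N ∣ (bound n N N≤n ℕ.≤-refl))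

  Null-* : ∀ x {f} → Null f → Null (λ m n → seq x m ℚ.* f m n)
  Null-* x {f} F ε 0<ε with eventually-bounded x
  ... | M , b , 0<b , below = result
    where
    instance
      b-positive : ℚ.Positive b
      b-positive = positive 0<b

      b-nonZero : ℚ.NonZero b
      b-nonZero = ℚ.pos⇒nonZero b

      1/b-positive : ℚ.Positive (ℚ.1/ b)
      1/b-positive = ℚ.1/pos⇒pos b

    δ : ℚ
    δ = ℚ.1/ b ℚ.* ε

    0<δ : 0ℚ ℚ.< δ
    0<δ = subst (ℚ._< δ) (ℚ.*-zeroʳ (ℚ.1/ b)) (ℚ.*-monoʳ-<-pos (ℚ.1/ b) 0<ε)

    b*δ≡ε : b ℚ.* δ ≡ ε
    b*δ≡ε = trans (sym (ℚ.*-assoc b (ℚ.1/ b) ε))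
      (trans (cong (ℚ._* ε) (ℚ.*-inverseʳ b)) (ℚ.*-identityˡ ε))

    result : ∃[ N ] (∀ m n → N ℕ.≤ m → N ℕ.≤ n → ℚ.∣ seq x m ℚ.* f m n ∣ ℚ.< ε)
    result with F δ 0<δ
    ... | N , bound = M ⊔ N , λ m n p q →
      subst (ℚ._< ε) (sym (ℚ.∣p*q∣≡∣p∣*∣q∣ (seq x m) (f m n)))
        (ℚ.≤-<-trans
          (ℚ.*-monoʳ-≤-nonNeg ℚ.∣ f m n ∣ {{ℚ.∣-∣-nonNeg (f m n)}}
            (ℚ.<⇒≤ (below m (ℕ.m⊔n≤o⇒m≤o M N p))))
          (subst (b ℚ.* ℚ.∣ f m n ∣ ℚ.<_) b*δ≡ε
            (ℚ.*-monoʳ-<-pos b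
              (bound m n (ℕ.m⊔n≤o⇒n≤o M N p) (ℕ.m⊔n≤o⇒n≤o M N q)))))

  +-null : ∀ x x′ y y′ → x ≈ℝ x′ → y ≈ℝ y′ →
           Null (λ m n → (seq x m ℚ.+ seq y m) ℚ.- (seq x′ n ℚ.+ seq y′ n))
  +-null x x′ y y′ p q = Null-cong
    (λ m n → difference-+ (seq x m) (seq x′ n) (seq y m) (seq y′ n))
    (Null-+ p q)

  *-null : ∀ x x′ y y′ → x ≈ℝ x′ → y ≈ℝ y′ →
           Null (λ m n → (seq x m ℚ.* seq y m) ℚ.- (seq x′ n ℚ.* seq y′ n))
  *-null x x′ y y′ p q = Null-cong
    (λ m n → difference-* (seq x m) (seq x′ n) (seq y m) (seq y′ n))
    (Null-+ (Null-* x q) (Null-swap (Null-* y′ (Null-swap p))))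

  neg-null : ∀ x x′ → x ≈ℝ x′ → Null (λ m n → ℚ.- seq x m ℚ.- ℚ.- seq x′ n)
  neg-null x x′ p = Null-cong
    (λ m n → difference-neg (seq x m) (seq x′ n))
    (Null-neg p)

infixl 6 _+ℝ_
infixl 7 _*ℝ_
infix  8 -ℝ_

fromℚ : ℚ → ℝ
fromℚ q = mkℝ (λ _ → q) λ ε 0<ε → 0 , λ _ _ _ _ →
  subst (λ p → ℚ.∣ p ∣ ℚ.< ε) (sym (ℚ.+-inverseʳ q)) 0<ε

_+ℝ_ : ℝ → ℝ → ℝ
x +ℝ y = mkℝ (λ n → seq x n ℚ.+ seq y n) (+-null x x y y (cauchy x) (cauchy y))

_*ℝ_ : ℝ → ℝ → ℝ
x *ℝ y = mkℝ (λ n → seq x n ℚ.* seq y n) (*-null x x y y (cauchy x) (cauchy y))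

-ℝ_ : ℝ → ℝ
-ℝ x = mkℝ (λ n → ℚ.- seq x n) (neg-null x x (cauchy x))

private
  pointwise : ∀ x y → (∀ n → seq x n ≡ seq y n) → x ≈ℝ y
  pointwise x y eq = Null-cong (λ m n → cong (λ q → seq x m ℚ.- q) (eq n)) (cauchy x)

  ≈ℝ-sym : ∀ x y → x ≈ℝ y → y ≈ℝ x
  ≈ℝ-sym x y p = Null-cong
    (λ m n → neg-difference (seq x n) (seq y m))
    (Null-neg (Null-swap p))

  ≈ℝ-trans : ∀ x y z → x ≈ℝ y → y ≈ℝ z → x ≈ℝ z
  ≈ℝ-trans x y z p q = Null-cong
    (λ m n → telescope (seq x m) (seq y m) (seq z n))
    (Null-+ (Null-swap (Null-diagonal p)) q)

ℝ-isCommutativeRing :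
  IsCommutativeRing _≈ℝ_ _+ℝ_ _*ℝ_ -ℝ_ (fromℚ 0ℚ) (fromℚ 1ℚ)
ℝ-isCommutativeRing = record
  { isRing = record
    { +-isAbelianGroup = record
      { isGroup = record
        { isMonoid = record
          { isSemigroup = record
            { isMagma = record
              { isEquivalence = record
                { refl  = λ {x} → cauchy x
                ; sym   = λ {x} {y} → ≈ℝ-sym x y
                ; trans = λ {x} {y} {z} → ≈ℝ-trans x y z
                }
              ; ∙-cong = λ {x} {x′} {y} {y′} → +-null x x′ y y′
              }
            ; assoc = λ x y z → pointwise ((x +ℝ y) +ℝ z) (x +ℝ (y +ℝ z))
                (λ n → ℚ.+-assoc (seq x n) (seq y n) (seq z n))
            }
          ; identity =
              (λ x → pointwise (fromℚ 0ℚ +ℝ x) x (λ n → ℚ.+-identityˡ (seq x n)))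
            , (λ x → pointwise (x +ℝ fromℚ 0ℚ) x (λ n → ℚ.+-identityʳ (seq x n)))
          }
        ; inverse =
            (λ x → pointwise (-ℝ x +ℝ x) (fromℚ 0ℚ) (λ n → ℚ.+-inverseˡ (seq x n)))
          , (λ x → pointwise (x +ℝ -ℝ x) (fromℚ 0ℚ) (λ n → ℚ.+-inverseʳ (seq x n)))
        ; ⁻¹-cong = λ {x} {x′} → neg-null x x′
        }
      ; comm = λ x y → pointwise (x +ℝ y) (y +ℝ x) (λ n → ℚ.+-comm (seq x n) (seq y n))
      }
    ; *-cong = λ {x} {x′} {y} {y′} → *-null x x′ y y′
    ; *-assoc = λ x y z → pointwise ((x *ℝ y) *ℝ z) (x *ℝ (y *ℝ z))
        (λ n → ℚ.*-assoc (seq x n) (seq y n) (seq z n))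
    ; *-identity =
        (λ x → pointwise (fromℚ 1ℚ *ℝ x) x (λ n → ℚ.*-identityˡ (seq x n)))
      , (λ x → pointwise (x *ℝ fromℚ 1ℚ) x (λ n → ℚ.*-identityʳ (seq x n)))
    ; distrib =
        (λ x y z → pointwise (x *ℝ (y +ℝ z)) (x *ℝ y +ℝ x *ℝ z)
          (λ n → ℚ.*-distribˡ-+ (seq x n) (seq y n) (seq z n)))
      , (λ x y z → pointwise ((y +ℝ z) *ℝ x) (y *ℝ x +ℝ z *ℝ x)
          (λ n → ℚ.*-distribʳ-+ (seq x n) (seq y n) (seq z n)))
    }
  ; *-comm = λ x y → pointwise (x *ℝ y) (y *ℝ x) (λ n → ℚ.*-comm (seq x n) (seq y n))
  }

ℝ-commutativeRing : CommutativeRing 0ℓ 0ℓ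
ℝ-commutativeRing = record { isCommutativeRing = ℝ-isCommutativeRing }

module Matrices {c ℓ} (K : CommutativeRing c ℓ) where
  open CommutativeRing K
  open MonoidSum +-monoid using (sum)

  Matrix : ℕ → ℕ → Set c
  Matrix m n = Fin m → Fin n → Carrier

  infixl 7 _⊗_ _⊗ᵥ_
  infixl 10 _ᵀ

  _ᵀ : ∀ {m n} → Matrix m n → Matrix n m
  (M ᵀ) i j = M j i

  _⊗_ : ∀ {l m n} → Matrix l m → Matrix m n → Matrix l n
  (M ⊗ N) i j = sum (λ k → M i k * N k j)

  _⊗ᵥ_ : ∀ {m n} → Matrix m n → (Fin n → Carrier) → (Fin m → Carrier)
  (M ⊗ᵥ x) i = sum (λ j → M i j * x j)

  ⟦_⟧ : Bool → Carrier
  ⟦ b ⟧ = if b then 1# else 0#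

  InEigenspace : ∀ {n} → Matrix n n → Carrier → (Fin n → Carrier) → Set ℓ
  InEigenspace M θ x = ∀ i → (M ⊗ᵥ x) i ≈ θ * x i

  combination : ∀ {k n} → (Fin k → Carrier) → (Fin k → Fin n → Carrier) → Fin n → Carrier
  combination a xs i = sum (λ j → a j * xs j i)

  -- The eigenspace of θ has dimension k; k = 0 means θ is not an eigenvalue.
  record HasMultiplicity {n} (M : Matrix n n) (θ : Carrier) (k : ℕ) : Set (c Level.⊔ ℓ) where
    field
      basis       : Fin k → Fin n → Carrier
      eigen       : ∀ j → InEigenspace M θ (basis j)
      independent : ∀ a → (∀ i → combination a basis i ≈ 0#) → ∀ j → a j ≈ 0#
      spanning    : ∀ x → InEigenspace M θ x → ∃[ a ] (∀ i → x i ≈ combination a basis i)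

  -- Geometric multiplicities determine the spectrum when, as for real
  -- symmetric matrices, they agree with the algebraic ones.
  SameSpectrum : ∀ {n} → Matrix n n → Matrix n n → Set (c Level.⊔ ℓ)
  SameSpectrum M N = ∀ θ k → HasMultiplicity M θ k ⇔ HasMultiplicity N θ k

record Graph (n : ℕ) : Set where
  field
    adj      : Fin n → Fin n → Bool
    symm     : ∀ u w → adj u w ≡ adj w u
    loopless : ∀ u → adj u u ≡ false

open Graph public

module _ where
  open Matrices ℝ-commutativeRing

  _+_J : ∀ {n} → Graph n → ℝ → Matrix n n
  (Γ + r J) u w = ⟦ adj Γ u w ⟧ +ℝ r

  ℝ-Cospectral : ∀ {n} → Graph n → Graph n → Set
  ℝ-Cospectral Γ Γ′ = ∀ r → SameSpectrum (Γ + r J) (Γ′ + r J)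

-- AG(3,2) and the cube.  The points are represented by the indices of
-- v₁, …, v₈ (shifted to start from 0), and coordinates are read off word.

word : Fin 8 → Vec Bool 3
word = lookup
  ( (false ∷ false ∷ false ∷ [])
  ∷ (true  ∷ true  ∷ true  ∷ [])
  ∷ (true  ∷ false ∷ true  ∷ [])
  ∷ (false ∷ true  ∷ false ∷ [])
  ∷ (true  ∷ true  ∷ false ∷ [])
  ∷ (false ∷ false ∷ true  ∷ [])
  ∷ (false ∷ true  ∷ true  ∷ [])
  ∷ (true  ∷ false ∷ false ∷ [])
  ∷ [])

infixl 6 _⊕_

_⊕_ : Vec Bool 3 → Vec Bool 3 → Vec Bool 3
_⊕_ = zipWith _xor_

CubeAdj : Fin 8 → Fin 8 → Set
CubeAdj i j = ∣ word i ⊕ word j ∣ ≡ 1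

-- p + ⟨a , b⟩ for linearly independent a and b
IsAffinePlane : Subset 8 → Set
IsAffinePlane S = ∃[ p ] ∃[ a ] ∃[ b ]
  a ≢ replicate 3 false × b ≢ replicate 3 false × a ≢ b ×
  (∀ i → i ∈ S ⇔ (word i ≡ p ⊎ word i ≡ p ⊕ a ⊎ word i ≡ p ⊕ b ⊎ word i ≡ p ⊕ a ⊕ b))

IsFace : Subset 8 → Set
IsFace S = ∃[ l ] ∃[ b ] (∀ i → i ∈ S ⇔ lookup (word i) l ≡ b)

-- the union of an edge xy and the opposite edge, formed by the antipodes
-- of x and y
IsDiagonalPlane : Subset 8 → Set
IsDiagonalPlane S = ∃[ x ] ∃[ y ] CubeAdj x y ×
  (∀ i → i ∈ S ⇔ (i ≡ x ⊎ i ≡ y ⊎ word i ≡ map not (word x) ⊎ word i ≡ map not (word y)))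

IsIndependentPlane : Subset 8 → Set
IsIndependentPlane S = ∣ S ∣ ≡ 4 × (∀ i j → i ∈ S → j ∈ S → ¬ CubeAdj i j)

image : Permutation′ 8 → Subset 8 → Subset 8
image π S = tabulate (λ i → lookup S (π ⟨$⟩ˡ i))

IsCubeAutomorphism : Permutation′ 8 → Set
IsCubeAutomorphism π = ∀ i j → CubeAdj i j ⇔ CubeAdj (π ⟨$⟩ʳ i) (π ⟨$⟩ʳ j)

HasOrder : Permutation′ 8 → ℕ → Set
HasOrder π d =
  (∀ i → fold i (π ⟨$⟩ʳ_) d ≡ i) ×
  (∀ m → 0 ℕ.< m → m ℕ.< d → ¬ (∀ i → fold i (π ⟨$⟩ʳ_) m ≡ i))

open Matrices ℚ.+-*-commutativeRing

private
  I Z -I -Z : Matrix 2 2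
  I i j = ⟦ does (i Fin.≟ j) ⟧
  Z i j = 1ℚ ℚ.- I i j
  -I i j = ℚ.- I i j
  -Z i j = ℚ.- Z i j

  blocks : Vec (Vec (Matrix 2 2) 4) 4
  blocks =
    (-I ∷  I ∷  I ∷  I ∷ []) ∷
    ( I ∷ -Z ∷  I ∷  Z ∷ []) ∷
    ( I ∷  Z ∷ -Z ∷  I ∷ []) ∷
    ( I ∷  I ∷  Z ∷ -Z ∷ []) ∷ []

R-cube : Matrix 8 8
R-cube i j with remQuot {4} 2 i | remQuot {4} 2 j
... | p , s | q , t = ½ ℚ.* lookup (lookup blocks p) q s t

-- R-cubeᵀ sends the characteristic vector of a face S to that of π(S).
RealisedByR-cube : Permutation′ 8 → Set
RealisedByR-cube π = ∀ S → IsFace S → ∀ i →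
  (R-cube ᵀ ⊗ᵥ (⟦_⟧ ∘ lookup S)) i ≡ ⟦ lookup (image π S) i ⟧

-- The entry 10 i + j stands for the edge vᵢvⱼ; index k holds B₍ₖ₊₁₎.
edges : Vec (List ℕ) 40
edges =
  [] ∷
  (14 ∷ 16 ∷ 18 ∷ 23 ∷ 25 ∷ 27 ∷ 36 ∷ 38 ∷ 45 ∷ 47 ∷ 58 ∷ 67 ∷ []) ∷
  (12 ∷ 34 ∷ 56 ∷ 78 ∷ []) ∷
  (17 ∷ 18 ∷ 27 ∷ 28 ∷ 35 ∷ 36 ∷ 45 ∷ 46 ∷ []) ∷
  (12 ∷ 17 ∷ 18 ∷ 27 ∷ 28 ∷ 34 ∷ 35 ∷ 36 ∷ 45 ∷ 46 ∷ 56 ∷ 78 ∷ []) ∷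
  (25 ∷ 26 ∷ 27 ∷ 36 ∷ 38 ∷ 45 ∷ 47 ∷ 48 ∷ 67 ∷ 78 ∷ []) ∷
  (24 ∷ 25 ∷ 27 ∷ 34 ∷ 36 ∷ 38 ∷ 45 ∷ 48 ∷ 56 ∷ 78 ∷ []) ∷
  (24 ∷ 25 ∷ 26 ∷ 27 ∷ 34 ∷ 36 ∷ 38 ∷ 45 ∷ 46 ∷ 48 ∷ 67 ∷ 78 ∷ []) ∷
  (23 ∷ 25 ∷ 27 ∷ 34 ∷ 56 ∷ 78 ∷ []) ∷
  (23 ∷ 25 ∷ 27 ∷ 28 ∷ 34 ∷ 38 ∷ 56 ∷ 68 ∷ []) ∷
  (23 ∷ 25 ∷ 26 ∷ 27 ∷ 28 ∷ 34 ∷ 38 ∷ 46 ∷ 67 ∷ 68 ∷ []) ∷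
  (23 ∷ 24 ∷ 25 ∷ 26 ∷ 27 ∷ 28 ∷ 38 ∷ 45 ∷ 46 ∷ 48 ∷ 67 ∷ 68 ∷ []) ∷
  (17 ∷ 27 ∷ 28 ∷ 35 ∷ 36 ∷ 38 ∷ 45 ∷ 46 ∷ 58 ∷ 78 ∷ []) ∷
  (17 ∷ 26 ∷ 28 ∷ 35 ∷ 45 ∷ 46 ∷ 47 ∷ 48 ∷ 56 ∷ 67 ∷ []) ∷
  (17 ∷ 26 ∷ 27 ∷ 28 ∷ 35 ∷ 38 ∷ 45 ∷ 46 ∷ 56 ∷ 58 ∷ 68 ∷ 78 ∷ []) ∷
  (17 ∷ 24 ∷ 25 ∷ 27 ∷ 34 ∷ 36 ∷ 38 ∷ 45 ∷ 47 ∷ 48 ∷ 56 ∷ 57 ∷ []) ∷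
  (17 ∷ 24 ∷ 25 ∷ 26 ∷ 27 ∷ 34 ∷ 36 ∷ 38 ∷ 45 ∷ 46 ∷ 47 ∷ 48 ∷ 57 ∷ 67 ∷ []) ∷
  (17 ∷ 23 ∷ 27 ∷ 28 ∷ 34 ∷ 36 ∷ 37 ∷ 38 ∷ 45 ∷ 46 ∷ 58 ∷ 78 ∷ []) ∷
  (17 ∷ 23 ∷ 26 ∷ 28 ∷ 34 ∷ 37 ∷ 45 ∷ 46 ∷ 47 ∷ 48 ∷ 56 ∷ 67 ∷ []) ∷
  (17 ∷ 23 ∷ 26 ∷ 27 ∷ 34 ∷ 45 ∷ 46 ∷ 47 ∷ 56 ∷ 57 ∷ 58 ∷ 67 ∷ []) ∷
  (17 ∷ 23 ∷ 26 ∷ 27 ∷ 28 ∷ 34 ∷ 37 ∷ 38 ∷ 45 ∷ 46 ∷ 56 ∷ 58 ∷ 68 ∷ 78 ∷ []) ∷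
  (17 ∷ 23 ∷ 24 ∷ 25 ∷ 37 ∷ 38 ∷ 45 ∷ 47 ∷ 56 ∷ 58 ∷ 68 ∷ 78 ∷ []) ∷
  (17 ∷ 23 ∷ 24 ∷ 25 ∷ 27 ∷ 45 ∷ 47 ∷ 48 ∷ 56 ∷ 57 ∷ []) ∷
  (17 ∷ 23 ∷ 24 ∷ 25 ∷ 26 ∷ 37 ∷ 38 ∷ 45 ∷ 46 ∷ 47 ∷ 58 ∷ 67 ∷ 68 ∷ 78 ∷ []) ∷
  (17 ∷ 23 ∷ 24 ∷ 25 ∷ 26 ∷ 27 ∷ 45 ∷ 46 ∷ 47 ∷ 48 ∷ 57 ∷ 67 ∷ []) ∷
  (17 ∷ 23 ∷ 24 ∷ 25 ∷ 26 ∷ 27 ∷ 37 ∷ 38 ∷ 45 ∷ 46 ∷ 58 ∷ 68 ∷ []) ∷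
  (17 ∷ 23 ∷ 24 ∷ 25 ∷ 26 ∷ 27 ∷ 28 ∷ 37 ∷ 38 ∷ 45 ∷ 46 ∷ 48 ∷ 68 ∷ 78 ∷ []) ∷
  (17 ∷ 18 ∷ 24 ∷ 25 ∷ 34 ∷ 36 ∷ 37 ∷ 38 ∷ 45 ∷ 47 ∷ 56 ∷ 68 ∷ []) ∷
  (17 ∷ 18 ∷ 24 ∷ 25 ∷ 27 ∷ 34 ∷ 36 ∷ 38 ∷ 45 ∷ 47 ∷ 56 ∷ 57 ∷ 68 ∷ 78 ∷ []) ∷
  (17 ∷ 18 ∷ 24 ∷ 25 ∷ 26 ∷ 34 ∷ 36 ∷ 37 ∷ 38 ∷ 45 ∷ 46 ∷ 47 ∷ 67 ∷ 68 ∷ []) ∷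
  (17 ∷ 18 ∷ 23 ∷ 26 ∷ 28 ∷ 34 ∷ 37 ∷ 45 ∷ 46 ∷ 47 ∷ 56 ∷ 67 ∷ 68 ∷ 78 ∷ []) ∷
  (17 ∷ 18 ∷ 23 ∷ 26 ∷ 27 ∷ 28 ∷ 34 ∷ 37 ∷ 45 ∷ 46 ∷ 56 ∷ 68 ∷ []) ∷
  (17 ∷ 18 ∷ 23 ∷ 24 ∷ 25 ∷ 37 ∷ 45 ∷ 47 ∷ 56 ∷ 68 ∷ []) ∷
  (17 ∷ 18 ∷ 23 ∷ 24 ∷ 25 ∷ 26 ∷ 37 ∷ 45 ∷ 46 ∷ 47 ∷ 67 ∷ 68 ∷ []) ∷
  (15 ∷ 18 ∷ 24 ∷ 26 ∷ 34 ∷ 45 ∷ 47 ∷ 48 ∷ 57 ∷ 67 ∷ 68 ∷ 78 ∷ []) ∷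
  (15 ∷ 18 ∷ 24 ∷ 26 ∷ 27 ∷ 34 ∷ 45 ∷ 48 ∷ 57 ∷ 68 ∷ []) ∷
  (15 ∷ 18 ∷ 24 ∷ 25 ∷ 34 ∷ 35 ∷ 36 ∷ 45 ∷ 47 ∷ 48 ∷ 67 ∷ 78 ∷ []) ∷
  (15 ∷ 18 ∷ 24 ∷ 25 ∷ 28 ∷ 34 ∷ 35 ∷ 36 ∷ 38 ∷ 45 ∷ 47 ∷ 48 ∷ 67 ∷ 68 ∷ []) ∷
  (15 ∷ 17 ∷ 18 ∷ 23 ∷ 26 ∷ 27 ∷ 28 ∷ 34 ∷ 35 ∷ 37 ∷ 45 ∷ 46 ∷ 58 ∷ 68 ∷ []) ∷
  (14 ∷ 16 ∷ 17 ∷ 23 ∷ 25 ∷ 28 ∷ 35 ∷ 38 ∷ 46 ∷ 47 ∷ 58 ∷ 67 ∷ []) ∷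
  []

B : Fin 40 → Fin 8 → Fin 8 → Bool
B k i j = any (λ e → (e ℕ.≡ᵇ code i j) ∨ (e ℕ.≡ᵇ code j i)) (lookup edges k)
  where
  code : Fin 8 → Fin 8 → ℕ
  code i j = 10 ℕ.* suc (toℕ i) ℕ.+ suc (toℕ j)

module _ {n : ℕ} where

  Outside : (Fin 8 → Fin n) → Fin n → Set
  Outside v u = ∀ i → u ≢ v i

  trace : Graph n → (Fin 8 → Fin n) → Fin n → Subset 8
  trace Γ v u = tabulate (λ i → adj Γ u (v i))

  record IsSwitchingSet (Γ : Graph n) (v : Fin 8 → Fin n) (k : Fin 40) : Set where
    field
      induced : ∀ i j → adj Γ (v i) (v j) ≡ B k i j
      traces  : ∀ u → Outside v u →
                trace Γ v u ≡ ⊤ ⊎ trace Γ v u ≡ ⊥ ⊎ IsAffinePlane (trace Γ v u)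

  record IsSwitched (Γ : Graph n) (v : Fin 8 → Fin n) (k : Fin 40)
                    (π : Permutation′ 8) (Γ′ : Graph n) : Set where
    field
      rest        : ∀ u w → Outside v u → Outside v w → adj Γ′ u w ≡ adj Γ u w
      trivial     : ∀ u → Outside v u → trace Γ v u ≡ ⊤ ⊎ trace Γ v u ≡ ⊥ →
                    trace Γ′ v u ≡ trace Γ v u
      face        : ∀ u → Outside v u → IsFace (trace Γ v u) →
                    trace Γ′ v u ≡ image π (trace Γ v u)
      diagonal    : ∀ u → Outside v u → IsDiagonalPlane (trace Γ v u) →
                    trace Γ′ v u ≡ ∁ (trace Γ v u)
      independent : ∀ u → Outside v u → IsIndependentPlane (trace Γ v u) →
                    trace Γ′ v u ≡ trace Γ v u
      B₁-B₅       : toℕ k ℕ.< 5 → ∀ i j → adj Γ′ (v i) (v j) ≡ adj Γ (v i) (v j)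
      B₆-B₄₀      : 5 ℕ.≤ toℕ k → ∀ i j →
                    ⟦ adj Γ′ (v i) (v j) ⟧ ≡
                    (R-cube ᵀ ⊗ (λ p q → ⟦ adj Γ (v p) (v q) ⟧) ⊗ R-cube) i j

{-# OPTIONS --safe #-}

-- Call a function on the cube even or odd according to its behaviour under
-- the antipodal map.  For π of order six let N act on functions on C as π on
-- the odd functions of degree one, as -1 on the even functions of sum zero,
-- and as the identity on the constants and on the parity function.  Then N is
-- orthogonal, fixes the all-ones vector and sends the characteristic vector of
-- each affine plane to that of its switched plane; for the π realised by
-- R-cube it is R-cubeᵀ.  If Q is N on C extended by the identity, the matrix
-- of Γ′ is Q A Q⁻¹, and Q J Q⁻¹ = J.  There are only eight π, so the finite
-- facts about N are evaluated for each of them.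

module Submission where

open import Defs
open import Algebra.Bundles using (CommutativeRing; Semiring)
open import Algebra.Morphism.Structures using (module SemiringMorphisms)
import Algebra.Properties.Semiring.Sum as SemiringSum
open import Data.Bool.Base using (Bool; true; false; not; _xor_; if_then_else_)
import Data.Bool.Properties as Bool
open import Data.Fin.Base using (Fin; zero; suc; toℕ)
open import Data.Fin.Permutation as Perm using (Permutation′; permutation; _⟨$⟩ʳ_; _⟨$⟩ˡ_)
import Data.Fin.Properties as Fin
open import Data.Fin.Subset using (Subset; _∈_; ⊤; ⊥; ∁; ∣_∣)
open import Data.Fin.Subset.Properties using (_∈?_)
open import Data.List.Base as List using (List; []; _∷_; concatMap; filter; allFin)
import Data.List.Membership.Propositional as List
open import Data.List.Membership.Propositional.Properties using (∈-concatMap⁺; ∈-filter⁺; ∈-map⁺; ∈-allFin)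
open import Data.List.Relation.Unary.All as All using (All)
open import Data.List.Relation.Unary.Any as Any using (Any; here)
open import Data.Nat.Base using (ℕ; zero; suc; _≤_; _<_; z<s; s<s)
open import Data.Nat.GeneralisedArithmetic using (fold)
import Data.Nat.Properties as ℕ
open import Data.Product.Base using (_×_; _,_; proj₁; proj₂; ∃-syntax)
open import Data.Rational.Base as ℚ using (ℚ; 0ℚ; 1ℚ; ½)
import Data.Rational.Properties as ℚ
open import Data.Sum.Base using (_⊎_; inj₁; inj₂; [_,_]′)
open import Data.Vec.Base using (Vec; []; _∷_; lookup; tabulate; map; replicate; foldr)
open import Data.Vec.Properties
  using (≡-dec; lookup∘tabulate; tabulate∘lookup; tabulate-cong; lookup-map; lookup-replicate; []=⇒lookup; lookup⇒[]=)
open import Function.Base using (_∘_)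
open import Function.Bundles using (_⇔_; mk⇔; Equivalence)
open import Function.Definitions using (Injective)
import Level
open import Relation.Binary.PropositionalEquality.Core using (_≡_; _≢_; refl; sym; trans; cong; cong₂; subst)
open import Relation.Binary.PropositionalEquality.Properties using (module ≡-Reasoning)
import Relation.Binary.Reasoning.Setoid as SetoidReasoning
open import Relation.Nullary using (Dec; yes; no; does; ¬_; contradiction)
open import Relation.Nullary.Decidable
  using (map′; _×-dec_; _⊎-dec_; _→-dec_; ¬?; from-yes; from-no; does-⇔; dec-true; dec-false)

-- Linear algebra over a commutative ring

-- With s_l = (-1)^(x_l), a face has indicator (1 ± s_l)/2, a diagonal plane (1 ± s_l s_m)/2 and an
-- independent plane (1 ± s_1 s_2 s_3)/2. The three switching rules thus act separately in degrees
-- one, two and three, and complementation is -1 in degree two: this is the origin of N. On the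
-- block the requirement is B′N = NB. The first five graphs commute with all eight N, so B′ = B
-- serves every π. For the others B′ is built from the one matrix `R-cube`, which can match at most
-- one π; hence `RealisedByR-cube` is assumed from index 5 on. Equality of Cauchy sequences cannot
-- be settled by evaluation, so the finite checks are made over `ℚ` and carried to `ℝ` by `fromℚ`.

position? : ∀ {m n} (v : Fin m → Fin n) (u : Fin n) → Dec (∃[ i ] u ≡ v i)
position? v u = Fin.any? (λ i → u Fin.≟ v i)

module LinearAlgebra {c ℓ} (K : CommutativeRing c ℓ) where
  open CommutativeRing K hiding (zero) renaming (refl to ≈-refl; sym to ≈-sym; trans to ≈-trans)
  open Matrices K
  open SemiringSum semiring
  open SetoidReasoning setoid

  IsIdentity : ∀ {n} → Matrix n n → Set ℓ
  IsIdentity M = ∀ i j → M i j ≈ ⟦ does (i Fin.≟ j) ⟧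

  -- Preservation of whole combinations takes the place of additivity, because bases enter
  -- `HasMultiplicity` in that form.
  record IsLinear {m n} (Q : (Fin m → Carrier) → (Fin n → Carrier)) : Set (c Level.⊔ ℓ) where
    field
      Q-cong        : ∀ {x y} → (∀ i → x i ≈ y i) → ∀ i → Q x i ≈ Q y i
      Q-scale       : ∀ a x i → Q (λ j → a * x j) i ≈ a * Q x i
      Q-combination : ∀ {k} (a : Fin k → Carrier) (xs : Fin k → Fin m → Carrier) i →
                      Q (combination a xs) i ≈ combination a (λ j → Q (xs j)) i

    Q-zero : ∀ x → (∀ i → x i ≈ 0#) → ∀ i → Q x i ≈ 0#
    -- The zero vector is the empty combination.
    Q-zero x x≈0 i = ≈-trans (Q-cong x≈0 i) (Q-combination {k = 0} (λ ()) (λ ()) i)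

  open IsLinear

  *-left-comm : ∀ a b d → a * (b * d) ≈ b * (a * d)
  *-left-comm a b d = ≈-trans (≈-sym (*-assoc a b d)) (≈-trans (*-congʳ (*-comm a b)) (*-assoc b a d))

  ⊗ᵥ-cong : ∀ {m n} {M N : Matrix m n} {x y} → (∀ i j → M i j ≈ N i j) → (∀ j → x j ≈ y j) →
            ∀ i → (M ⊗ᵥ x) i ≈ (N ⊗ᵥ y) i
  ⊗ᵥ-cong M≈N x≈y i = sum-cong-≋ (λ j → *-cong (M≈N i j) (x≈y j))

  ⊗ᵥ-linear : ∀ {m n} (M : Matrix m n) → IsLinear (M ⊗ᵥ_)
  ⊗ᵥ-linear M .Q-cong x≈y i = sum-cong-≋ (λ j → *-congˡ (x≈y j))
  ⊗ᵥ-linear M .Q-scale a x i = begin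
    sum (λ j → M i j * (a * x j))  ≈⟨ sum-cong-≋ (λ j → *-left-comm (M i j) a (x j)) ⟩
    sum (λ j → a * (M i j * x j))  ≈⟨ *-distribˡ-sum a (λ j → M i j * x j) ⟨
    a * (M ⊗ᵥ x) i                 ∎
  ⊗ᵥ-linear M .Q-combination a xs i = begin
    sum (λ j → M i j * sum (λ k → a k * xs k j))
      ≈⟨ sum-cong-≋ (λ j → *-distribˡ-sum (M i j) (λ k → a k * xs k j)) ⟩
    sum (λ j → sum (λ k → M i j * (a k * xs k j)))
      ≈⟨ ∑-comm (λ j k → M i j * (a k * xs k j)) ⟩
    sum (λ k → sum (λ j → M i j * (a k * xs k j)))
      ≈⟨ sum-cong-≋ (λ k → ⊗ᵥ-linear M .Q-scale (a k) (xs k) i) ⟩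
    combination a (λ k → M ⊗ᵥ xs k) i ∎

  ⊗ᵥ-assoc : ∀ {l m n} (M : Matrix l m) (N : Matrix m n) x i →
             ((M ⊗ N) ⊗ᵥ x) i ≈ (M ⊗ᵥ (N ⊗ᵥ x)) i
  ⊗ᵥ-assoc M N x i = begin
    sum (λ k → sum (λ j → M i j * N j k) * x k)
      ≈⟨ sum-cong-≋ (λ k → *-distribʳ-sum (x k) (λ j → M i j * N j k)) ⟩
    sum (λ k → sum (λ j → M i j * N j k * x k))
      ≈⟨ ∑-comm (λ k j → M i j * N j k * x k) ⟩
    sum (λ j → sum (λ k → M i j * N j k * x k))
      ≈⟨ sum-cong-≋ (λ j → ≈-trans (sum-cong-≋ (λ k → *-assoc (M i j) (N j k) (x k)))
                                 (≈-sym (*-distribˡ-sum (M i j) (λ k → N j k * x k)))) ⟩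
    (M ⊗ᵥ (N ⊗ᵥ x)) i ∎

  indicator-sum : ∀ {n} (i : Fin n) (x : Fin n → Carrier) →
                  sum (λ j → ⟦ does (i Fin.≟ j) ⟧ * x j) ≈ x i
  indicator-sum {suc n} zero x = begin
    1# * x zero + sum (λ j → 0# * x (suc j))  ≈⟨ +-cong (*-identityˡ _) (sum-cong-≋ (λ j → zeroˡ (x (suc j)))) ⟩
    x zero + sum {n} (λ _ → 0#)               ≈⟨ +-congˡ (sum-replicate-zero n) ⟩
    x zero + 0#                               ≈⟨ +-identityʳ _ ⟩
    x zero                                    ∎
  indicator-sum (suc i) x = begin
    0# * x zero + sum (λ j → ⟦ does (i Fin.≟ j) ⟧ * x (suc j))  ≈⟨ +-cong (zeroˡ _) (indicator-sum i (x ∘ suc)) ⟩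
    0# + x (suc i)                                              ≈⟨ +-identityˡ _ ⟩
    x (suc i)                                                   ∎

  indicator-sum′ : ∀ {n} (i : Fin n) (x : Fin n → Carrier) →
                   sum (λ j → ⟦ does (j Fin.≟ i) ⟧ * x j) ≈ x i
  indicator-sum′ i x = ≈-trans
    (sum-cong-≋ (λ j → *-congʳ (reflexive (cong ⟦_⟧ (does-⇔ (mk⇔ sym sym) (j Fin.≟ i) (i Fin.≟ j))))))
    (indicator-sum i x)

  ⊗ᵥ-identity : ∀ {n} {M : Matrix n n} → IsIdentity M → ∀ x i → (M ⊗ᵥ x) i ≈ x i
  ⊗ᵥ-identity M≈1 x i = ≈-trans (sum-cong-≋ (λ j → *-congʳ (M≈1 i j))) (indicator-sum i x)

  -- `Q` restricts to an isomorphism between the eigenspaces for `θ`, with inverse `P`, and so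
  -- carries a basis to a basis.
  multiplicity-transfer : ∀ {n} {M M′ : Matrix n n} {Q P} → IsLinear Q → IsLinear P →
    (∀ x i → P (Q x) i ≈ x i) → (∀ x i → Q (P x) i ≈ x i) →
    (∀ x i → (M′ ⊗ᵥ Q x) i ≈ Q (M ⊗ᵥ x) i) →
    ∀ {θ k} → HasMultiplicity M θ k → HasMultiplicity M′ θ k
  multiplicity-transfer {M = M} {M′} {Q} {P} QL PL PQ QP QM {θ} H = record
    { basis       = λ j → Q (basis j)
    ; eigen       = λ j i → ≈-trans (QM (basis j) i)
                      (≈-trans (Q-cong QL (eigen j) i) (Q-scale QL θ (basis j) i))
    ; independent = λ a a·Qb≈0 → independent a (λ i → begin
        combination a basis i          ≈⟨ PQ (combination a basis) i ⟨
        P (Q (combination a basis)) i  ≈⟨ Q-zero PL _ (λ u → ≈-trans (Q-combination QL a basis u) (a·Qb≈0 u)) i ⟩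
        0#                             ∎)
    ; spanning    = λ x x∈E → let a , Px≈ = spanning (P x) (P-eigen x∈E) in a , λ i → begin
        x i                                  ≈⟨ QP x i ⟨
        Q (P x) i                            ≈⟨ Q-cong QL Px≈ i ⟩
        Q (combination a basis) i            ≈⟨ Q-combination QL a basis i ⟩
        combination a (λ j → Q (basis j)) i  ∎
    }
    where
    open HasMultiplicity H

    -- The intertwining relation is given for `Q`; for `P` it is recovered by inserting `P ∘ Q` on
    -- the left and cancelling `Q ∘ P` on the right.
    P-eigen : ∀ {x} → InEigenspace M′ θ x → InEigenspace M θ (P x)
    P-eigen {x} x∈E i = begin
      (M ⊗ᵥ P x) i         ≈⟨ PQ (M ⊗ᵥ P x) i ⟨
      P (Q (M ⊗ᵥ P x)) i   ≈⟨ Q-cong PL (λ u → QM (P x) u) i ⟨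
      P (M′ ⊗ᵥ Q (P x)) i  ≈⟨ Q-cong PL (Q-cong (⊗ᵥ-linear M′) (QP x)) i ⟩
      P (M′ ⊗ᵥ x) i        ≈⟨ Q-cong PL x∈E i ⟩
      P (λ u → θ * x u) i  ≈⟨ Q-scale PL θ x i ⟩
      θ * P x i            ∎

  -- Switching on a block of coordinates

  module _ {m n} (v : Fin m → Fin n) where

    off : (Fin n → Carrier) → Fin n → Carrier
    off f w = if does (position? v w) then 0# else f w

    extend : Matrix m m → (Fin n → Carrier) → Fin n → Carrier
    extend N x u with position? v u
    ... | yes (i , _) = (N ⊗ᵥ (x ∘ v)) i
    ... | no  _       = x u

    extend-linear : ∀ N → IsLinear (extend N)
    extend-linear N .Q-cong x≈y u with position? v u
    ... | yes (i , _) = Q-cong (⊗ᵥ-linear N) (x≈y ∘ v) i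
    ... | no  _       = x≈y u
    extend-linear N .Q-scale a x u with position? v u
    ... | yes (i , _) = Q-scale (⊗ᵥ-linear N) a (x ∘ v) i
    ... | no  _       = ≈-refl
    extend-linear N .Q-combination a xs u with position? v u
    ... | yes (i , _) = Q-combination (⊗ᵥ-linear N) a (λ k → xs k ∘ v) i
    ... | no  _       = ≈-refl

    -- The four blocks of A′Q = QA, where Q is `N` on the positions of `v` and the identity
    -- elsewhere. This form, unlike A′ = QAQ⁻¹, keeps inverses out of the entrywise conditions.
    record IsSwitching (N : Matrix m m) (A A′ : Matrix n n) : Set ℓ where
      Out : Fin n → Set
      Out u = ∀ i → u ≢ v i
      field
        rest  : ∀ u w → Out u → Out w → A′ u w ≈ A u w
        row   : ∀ u → Out u → ∀ j → sum (λ i → A′ u (v i) * N i j) ≈ A u (v j)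
        col   : ∀ w → Out w → ∀ i → A′ (v i) w ≈ (N ⊗ᵥ (λ j → A (v j) w)) i
        block : ∀ i j → ((λ p q → A′ (v p) (v q)) ⊗ N) i j ≈ (N ⊗ (λ p q → A (v p) (v q))) i j

    off-cong : ∀ {f g} → (∀ w → (∀ i → w ≢ v i) → f w ≈ g w) → sum (off f) ≈ sum (off g)
    off-cong {f} {g} f≈g = sum-cong-≋ step
      where
      step : ∀ w → off f w ≈ off g w
      step w with position? v w
      ... | yes _ = ≈-refl
      ... | no ¬p = f≈g w (λ i w≡vi → ¬p (i , w≡vi))

    module _ (v-injective : Injective _≡_ _≡_ v) where

      -- By injectivity the indicators of `w ≡ v i` sum over `i` to 1 on the image of `v`, and to 0
      -- elsewhere; exchanging the two sums leaves the sum over `Fin m`.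
      split-sum : ∀ f → sum f ≈ sum (off f) + sum (f ∘ v)
      split-sum f = begin
        sum f
          ≈⟨ sum-cong-≋ step ⟩
        sum (λ w → off f w + sum (λ i → ⟦ does (w Fin.≟ v i) ⟧ * f w))
          ≈⟨ ∑-distrib-+ (off f) _ ⟩
        sum (off f) + sum (λ w → sum (λ i → ⟦ does (w Fin.≟ v i) ⟧ * f w))
          ≈⟨ +-congˡ (∑-comm (λ w i → ⟦ does (w Fin.≟ v i) ⟧ * f w)) ⟩
        sum (off f) + sum (λ i → sum (λ w → ⟦ does (w Fin.≟ v i) ⟧ * f w))
          ≈⟨ +-congˡ (sum-cong-≋ (λ i → indicator-sum′ (v i) f)) ⟩
        sum (off f) + sum (f ∘ v) ∎
        where
        step : ∀ w → f w ≈ off f w + sum (λ i → ⟦ does (w Fin.≟ v i) ⟧ * f w)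
        step w with position? v w
        ... | yes (i , refl) = begin
          f (v i)
            ≈⟨ indicator-sum i (λ _ → f (v i)) ⟨
          sum (λ j → ⟦ does (i Fin.≟ j) ⟧ * f (v i))
            ≈⟨ sum-cong-≋ (λ j → *-congʳ (reflexive (cong ⟦_⟧
                 (does-⇔ (mk⇔ (cong v) v-injective) (i Fin.≟ j) (v i Fin.≟ v j))))) ⟩
          sum (λ j → ⟦ does (v i Fin.≟ v j) ⟧ * f (v i))
            ≈⟨ +-identityˡ _ ⟨
          0# + sum (λ j → ⟦ does (v i Fin.≟ v j) ⟧ * f (v i)) ∎
        ... | no ¬p = begin
          f w                     ≈⟨ +-identityʳ _ ⟨
          f w + 0#                ≈⟨ +-congˡ (sum-replicate-zero m) ⟨
          f w + sum {m} (λ _ → 0#)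
            ≈⟨ +-congˡ (sum-cong-≋ (λ i → ≈-trans (≈-sym (zeroˡ (f w))) (*-congʳ (reflexive (cong ⟦_⟧
                 (sym (dec-false (w Fin.≟ v i) (λ w≡vi → ¬p (i , w≡vi))))))))) ⟩
          f w + sum (λ i → ⟦ does (w Fin.≟ v i) ⟧ * f w) ∎

      extend-on : ∀ N x i → extend N x (v i) ≡ (N ⊗ᵥ (x ∘ v)) i
      extend-on N x i with position? v (v i)
      ... | yes (j , vi≡vj) = cong (N ⊗ᵥ (x ∘ v)) (v-injective (sym vi≡vj))
      ... | no ¬p = contradiction (i , refl) ¬p

      extend-off : ∀ N x u → (∀ i → u ≢ v i) → extend N x u ≡ x u
      extend-off N x u out with position? v u
      ... | yes (i , u≡vi) = contradiction u≡vi (out i)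
      ... | no  _          = refl

      on-or-off : (P : Fin n → Set ℓ) → (∀ i → P (v i)) → (∀ u → (∀ i → u ≢ v i) → P u) → ∀ u → P u
      on-or-off P on off u with position? v u
      ... | yes (i , refl) = on i
      ... | no ¬p            = off u (λ i u≡vi → ¬p (i , u≡vi))

      extend-inverse : ∀ {N N′} → IsIdentity (N ⊗ N′) → ∀ x u → extend N (extend N′ x) u ≈ x u
      extend-inverse {N} {N′} NN′≈1 x = on-or-off _
        (λ i → begin
          extend N (extend N′ x) (v i)     ≡⟨ extend-on N (extend N′ x) i ⟩
          (N ⊗ᵥ (extend N′ x ∘ v)) i       ≈⟨ Q-cong (⊗ᵥ-linear N) (λ j → reflexive (extend-on N′ x j)) i ⟩
          (N ⊗ᵥ (N′ ⊗ᵥ (x ∘ v))) i         ≈⟨ ⊗ᵥ-assoc N N′ (x ∘ v) i ⟨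
          ((N ⊗ N′) ⊗ᵥ (x ∘ v)) i          ≈⟨ ⊗ᵥ-identity NN′≈1 (x ∘ v) i ⟩
          x (v i)                          ∎)
        (λ u out → reflexive (trans (extend-off N (extend N′ x) u out) (extend-off N′ x u out)))

      module _ {N A A′} (S : IsSwitching N A A′) where
        open IsSwitching S

        split-product : ∀ (M : Matrix n n) x u →
          (M ⊗ᵥ x) u ≈ sum (off (λ w → M u w * x w)) + sum (λ j → M u (v j) * x (v j))
        split-product M x u = split-sum (λ w → M u w * x w)

        split-extended : ∀ u x →
          (A′ ⊗ᵥ extend N x) u ≈
          sum (off (λ w → A′ u w * x w)) + sum (λ j → sum (λ i → A′ u (v i) * N i j) * x (v j))
        split-extended u x = begin
          (A′ ⊗ᵥ extend N x) u
            ≈⟨ split-product A′ (extend N x) u ⟩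
          sum (off (λ w → A′ u w * extend N x w)) + sum (λ i → A′ u (v i) * extend N x (v i))
            ≈⟨ +-cong (off-cong (λ w out → *-congˡ (reflexive (extend-off N x w out))))
                      (sum-cong-≋ (λ i → *-congˡ (reflexive (extend-on N x i)))) ⟩
          sum (off (λ w → A′ u w * x w)) + sum (λ i → A′ u (v i) * (N ⊗ᵥ (x ∘ v)) i)
            -- The row of `A′` at `u` is read as a matrix with a single row, so that associativity
            -- applies.
            ≈⟨ +-congˡ (⊗ᵥ-assoc (λ (p : Fin 1) q → A′ u (v q)) N (x ∘ v) zero) ⟨
          sum (off (λ w → A′ u w * x w)) + sum (λ j → sum (λ i → A′ u (v i) * N i j) * x (v j)) ∎

        off-combination : ∀ (a : Fin m → Carrier) (f : Fin m → Fin n → Carrier) →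
          sum (λ j → a j * sum (off (f j))) ≈ sum (off (λ w → sum (λ j → a j * f j w)))
        off-combination a f = begin
          sum (λ j → a j * sum (off (f j)))
            ≈⟨ sum-cong-≋ (λ j → *-distribˡ-sum (a j) (off (f j))) ⟩
          sum (λ j → sum (λ w → a j * off (f j) w))
            ≈⟨ ∑-comm (λ j w → a j * off (f j) w) ⟩
          sum (λ w → sum (λ j → a j * off (f j) w))
            ≈⟨ sum-cong-≋ step ⟩
          sum (off (λ w → sum (λ j → a j * f j w))) ∎
          where
          step : ∀ w → sum (λ j → a j * off (f j) w) ≈ off (λ w → sum (λ j → a j * f j w)) w
          step w with position? v w
          ... | yes _ = ≈-trans (sum-cong-≋ (λ j → zeroʳ (a j))) (sum-replicate-zero m)
          ... | no  _ = ≈-refl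

        intertwines : ∀ x u → (A′ ⊗ᵥ extend N x) u ≈ extend N (A ⊗ᵥ x) u
        intertwines x = on-or-off _ on-block off-block
          where
          on-block : ∀ i → (A′ ⊗ᵥ extend N x) (v i) ≈ extend N (A ⊗ᵥ x) (v i)
          on-block i = begin
            (A′ ⊗ᵥ extend N x) (v i)
              ≈⟨ split-extended (v i) x ⟩
            sum (off (λ w → A′ (v i) w * x w)) + sum (λ j → sum (λ p → A′ (v i) (v p) * N p j) * x (v j))
              ≈⟨ +-cong (off-cong outer) (≈-trans (sum-cong-≋ (λ j → *-congʳ (block i j)))
                                                (⊗ᵥ-assoc N (λ p q → A (v p) (v q)) (x ∘ v) i)) ⟩
            sum (off (λ w → sum (λ j → N i j * (A (v j) w * x w))))
              + sum (λ j → N i j * sum (λ q → A (v j) (v q) * x (v q)))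
              ≈⟨ +-congʳ (off-combination (N i) (λ j w → A (v j) w * x w)) ⟨
            sum (λ j → N i j * sum (off (λ w → A (v j) w * x w)))
              + sum (λ j → N i j * sum (λ q → A (v j) (v q) * x (v q)))
              ≈⟨ ∑-distrib-+ (λ j → N i j * sum (off (λ w → A (v j) w * x w))) _ ⟨
            sum (λ j → N i j * sum (off (λ w → A (v j) w * x w))
                     + N i j * sum (λ q → A (v j) (v q) * x (v q)))
              ≈⟨ sum-cong-≋ (λ j → ≈-trans (≈-sym (distribˡ (N i j) _ _)) (*-congˡ (≈-sym (split-product A x (v j))))) ⟩
            (N ⊗ᵥ ((A ⊗ᵥ x) ∘ v)) i
              ≡⟨ extend-on N (A ⊗ᵥ x) i ⟨
            extend N (A ⊗ᵥ x) (v i) ∎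
            where
            outer : ∀ w → Out w → A′ (v i) w * x w ≈ sum (λ j → N i j * (A (v j) w * x w))
            outer w out = begin
              A′ (v i) w * x w                          ≈⟨ *-congʳ (col w out i) ⟩
              (N ⊗ᵥ (λ j → A (v j) w)) i * x w          ≈⟨ *-distribʳ-sum (x w) (λ j → N i j * A (v j) w) ⟩
              sum (λ j → N i j * A (v j) w * x w)       ≈⟨ sum-cong-≋ (λ j → *-assoc (N i j) (A (v j) w) (x w)) ⟩
              sum (λ j → N i j * (A (v j) w * x w))     ∎

          off-block : ∀ u → Out u → (A′ ⊗ᵥ extend N x) u ≈ extend N (A ⊗ᵥ x) u
          off-block u out = begin
            (A′ ⊗ᵥ extend N x) u
              ≈⟨ split-extended u x ⟩
            sum (off (λ w → A′ u w * x w)) + sum (λ j → sum (λ p → A′ u (v p) * N p j) * x (v j))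
              ≈⟨ +-cong (off-cong (λ w out-w → *-congʳ (rest u w out out-w)))
                        (sum-cong-≋ (λ j → *-congʳ (row u out j))) ⟩
            sum (off (λ w → A u w * x w)) + sum (λ j → A u (v j) * x (v j))
              ≈⟨ split-product A x u ⟨
            (A ⊗ᵥ x) u
              ≡⟨ extend-off N (A ⊗ᵥ x) u out ⟨
            extend N (A ⊗ᵥ x) u ∎

      switching-sameSpectrum : ∀ {N N⁻¹ A A′} → IsIdentity (N ⊗ N⁻¹) → IsIdentity (N⁻¹ ⊗ N) →
        IsSwitching N A A′ → SameSpectrum A A′
      switching-sameSpectrum {N} {N⁻¹} {A} {A′} NN⁻¹ N⁻¹N S θ k = mk⇔
        (multiplicity-transfer (extend-linear N) (extend-linear N⁻¹) PQ QP (intertwines S))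
        -- For the converse, AQ⁻¹ = Q⁻¹A′ follows from A′Q = QA by multiplying with Q⁻¹ on both
        -- sides.
        (multiplicity-transfer (extend-linear N⁻¹) (extend-linear N) QP PQ (λ x u → begin
          (A ⊗ᵥ extend N⁻¹ x) u
            ≈⟨ PQ (A ⊗ᵥ extend N⁻¹ x) u ⟨
          extend N⁻¹ (extend N (A ⊗ᵥ extend N⁻¹ x)) u
            ≈⟨ Q-cong (extend-linear N⁻¹) (intertwines S (extend N⁻¹ x)) u ⟨
          extend N⁻¹ (A′ ⊗ᵥ extend N (extend N⁻¹ x)) u
            ≈⟨ Q-cong (extend-linear N⁻¹) (Q-cong (⊗ᵥ-linear A′) (QP x)) u ⟩
          extend N⁻¹ (A′ ⊗ᵥ x) u ∎))
        where
        PQ : ∀ x u → extend N⁻¹ (extend N x) u ≈ x u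
        PQ = extend-inverse N⁻¹N

        QP : ∀ x u → extend N (extend N⁻¹ x) u ≈ x u
        QP = extend-inverse NN⁻¹

    -- Row sums 1 mean NJ = J and column sums 1 mean JN = J, so adding `r` to every entry changes
    -- both sides of each condition equally.
    switching-shift : ∀ {N A A′} → (∀ i → sum (N i) ≈ 1#) → (∀ j → sum (λ i → N i j) ≈ 1#) →
      IsSwitching N A A′ → ∀ r → IsSwitching N (λ u w → A u w + r) (λ u w → A′ u w + r)
    switching-shift {N} {A} {A′} rows cols S r = record
      { rest  = λ u w out-u out-w → +-congʳ (rest u w out-u out-w)
      ; row   = λ u out j → ≈-trans (shiftˡ (λ i → A′ u (v i)) j) (+-congʳ (row u out j))
      ; col   = λ w out i → ≈-trans (+-congʳ (col w out i)) (≈-sym (shiftʳ (λ j → A (v j) w) i))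
      ; block = λ i j → ≈-trans (shiftˡ (λ p → A′ (v i) (v p)) j)
                  (≈-trans (+-congʳ (block i j)) (≈-sym (shiftʳ (λ q → A (v q) (v j)) i)))
      }
      where
      open IsSwitching S

      shiftˡ : ∀ x j → sum (λ i → (x i + r) * N i j) ≈ sum (λ i → x i * N i j) + r
      shiftˡ x j = begin
        sum (λ i → (x i + r) * N i j)                          ≈⟨ sum-cong-≋ (λ i → distribʳ (N i j) (x i) r) ⟩
        sum (λ i → x i * N i j + r * N i j)                    ≈⟨ ∑-distrib-+ (λ i → x i * N i j) _ ⟩
        sum (λ i → x i * N i j) + sum (λ i → r * N i j)        ≈⟨ +-congˡ (*-distribˡ-sum r (λ i → N i j)) ⟨
        sum (λ i → x i * N i j) + r * sum (λ i → N i j)        ≈⟨ +-congˡ (≈-trans (*-congˡ (cols j)) (*-identityʳ r)) ⟩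
        sum (λ i → x i * N i j) + r                            ∎

      shiftʳ : ∀ x i → sum (λ j → N i j * (x j + r)) ≈ sum (λ j → N i j * x j) + r
      shiftʳ x i = begin
        sum (λ j → N i j * (x j + r))                          ≈⟨ sum-cong-≋ (λ j → distribˡ (N i j) (x j) r) ⟩
        sum (λ j → N i j * x j + N i j * r)                    ≈⟨ ∑-distrib-+ (λ j → N i j * x j) _ ⟩
        sum (λ j → N i j * x j) + sum (λ j → N i j * r)        ≈⟨ +-congˡ (*-distribʳ-sum r (N i)) ⟨
        sum (λ j → N i j * x j) + sum (N i) * r                ≈⟨ +-congˡ (≈-trans (*-congʳ (rows i)) (*-identityˡ r)) ⟩
        sum (λ j → N i j * x j) + r                            ∎

-- Transfer along a homomorphism of coefficient rings

module Transport {c ℓ c′ ℓ′} (K : CommutativeRing c ℓ) (K′ : CommutativeRing c′ ℓ′)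
  (φ : CommutativeRing.Carrier K → CommutativeRing.Carrier K′)
  (φ-homo : SemiringMorphisms.IsSemiringHomomorphism
    (Semiring.rawSemiring (CommutativeRing.semiring K)) (Semiring.rawSemiring (CommutativeRing.semiring K′)) φ) where
  open CommutativeRing K′ hiding (zero) renaming (sym to ≈-sym; trans to ≈-trans; refl to ≈-refl)
  open SemiringSum semiring
  open SetoidReasoning setoid
  private module K = CommutativeRing K
  private module LK = LinearAlgebra K
  private module MK = Matrices K
  open Matrices K′
  open LinearAlgebra K′
  open SemiringMorphisms.IsSemiringHomomorphism φ-homo
  private module ΣK = SemiringSum K.semiring

  ⟦⟧-homo : ∀ b → ⟦ b ⟧ ≈ φ MK.⟦ b ⟧
  ⟦⟧-homo false = ≈-sym 0#-homo
  ⟦⟧-homo true  = ≈-sym 1#-homo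

  sum-homo : ∀ {n} (f : Fin n → K.Carrier) → φ (ΣK.sum f) ≈ sum (φ ∘ f)
  sum-homo {zero}  f = 0#-homo
  sum-homo {suc n} f = ≈-trans (+-homo (f zero) _) (+-congˡ (sum-homo (f ∘ suc)))

  product-homo : ∀ {n} (f g : Fin n → K.Carrier) →
                 φ (ΣK.sum (λ i → f i K.* g i)) ≈ sum (λ i → φ (f i) * φ (g i))
  product-homo f g = ≈-trans (sum-homo (λ i → f i K.* g i)) (sum-cong-≋ (λ i → *-homo (f i) (g i)))

  identity-map : ∀ {n} {M N : MK.Matrix n n} → LK.IsIdentity (M MK.⊗ N) →
                 IsIdentity ((λ i j → φ (M i j)) ⊗ (λ i j → φ (N i j)))
  identity-map {M = M} {N} MN≈1 i j = begin
    sum (λ k → φ (M i k) * φ (N k j))  ≈⟨ product-homo (M i) (λ k → N k j) ⟨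
    φ ((M MK.⊗ N) i j)                 ≈⟨ ⟦⟧-cong (MN≈1 i j) ⟩
    φ MK.⟦ does (i Fin.≟ j) ⟧          ≈⟨ ⟦⟧-homo (does (i Fin.≟ j)) ⟨
    ⟦ does (i Fin.≟ j) ⟧               ∎

  -- The conditions are polynomial identities in the entries, hence survive a homomorphism. `C` and
  -- `C′` are images only up to `_≈_`, since each ring interprets a Boolean by its own 0 and 1.
  switching-map : ∀ {m n} {v : Fin m → Fin n} {N : MK.Matrix m m} {A A′ : MK.Matrix n n} {C C′ : Matrix n n} →
    (∀ u w → C u w ≈ φ (A u w)) → (∀ u w → C′ u w ≈ φ (A′ u w)) →
    LK.IsSwitching v N A A′ → IsSwitching v (λ i j → φ (N i j)) C C′
  switching-map {v = v} {N} {A} {A′} {C} {C′} C≈A C′≈A′ S = record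
    { rest  = λ u w out-u out-w →
        ≈-trans (C′≈A′ u w) (≈-trans (⟦⟧-cong (S.rest u w out-u out-w)) (≈-sym (C≈A u w)))
    ; row   = λ u out j → begin
        sum (λ i → C′ u (v i) * φ (N i j))        ≈⟨ sum-cong-≋ (λ i → *-congʳ (C′≈A′ u (v i))) ⟩
        sum (λ i → φ (A′ u (v i)) * φ (N i j))    ≈⟨ product-homo (λ i → A′ u (v i)) (λ i → N i j) ⟨
        φ (ΣK.sum (λ i → A′ u (v i) K.* N i j))   ≈⟨ ⟦⟧-cong (S.row u out j) ⟩
        φ (A u (v j))                             ≈⟨ C≈A u (v j) ⟨
        C u (v j)                                 ∎
    ; col   = λ w out i → begin
        C′ (v i) w                                ≈⟨ C′≈A′ (v i) w ⟩
        φ (A′ (v i) w)                            ≈⟨ ⟦⟧-cong (S.col w out i) ⟩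
        φ (ΣK.sum (λ j → N i j K.* A (v j) w))    ≈⟨ product-homo (N i) (λ j → A (v j) w) ⟩
        sum (λ j → φ (N i j) * φ (A (v j) w))     ≈⟨ sum-cong-≋ (λ j → *-congˡ (C≈A (v j) w)) ⟨
        sum (λ j → φ (N i j) * C (v j) w)         ∎
    ; block = λ i j → begin
        sum (λ p → C′ (v i) (v p) * φ (N p j))
          ≈⟨ sum-cong-≋ (λ p → *-congʳ (C′≈A′ (v i) (v p))) ⟩
        sum (λ p → φ (A′ (v i) (v p)) * φ (N p j))
          ≈⟨ product-homo (λ p → A′ (v i) (v p)) (λ p → N p j) ⟨
        φ (ΣK.sum (λ p → A′ (v i) (v p) K.* N p j))
          ≈⟨ ⟦⟧-cong (S.block i j) ⟩
        φ (ΣK.sum (λ q → N i q K.* A (v q) (v j)))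
          ≈⟨ product-homo (N i) (λ q → A (v q) (v j)) ⟩
        sum (λ q → φ (N i q) * φ (A (v q) (v j)))
          ≈⟨ sum-cong-≋ (λ q → *-congˡ (C≈A (v q) (v j))) ⟨
        sum (λ q → φ (N i q) * C (v q) (v j)) ∎
    }
    where module S = LK.IsSwitching S

  similar : ∀ {m n} {v : Fin m → Fin n} → Injective _≡_ _≡_ v →
    ∀ {N N⁻¹ : MK.Matrix m m} {A A′ : MK.Matrix n n} {C C′ : Matrix n n} →
    LK.IsIdentity (N MK.⊗ N⁻¹) → LK.IsIdentity (N⁻¹ MK.⊗ N) →
    (∀ i → ΣK.sum (N i) K.≈ K.1#) → (∀ j → ΣK.sum (λ i → N i j) K.≈ K.1#) →
    (∀ u w → C u w ≈ φ (A u w)) → (∀ u w → C′ u w ≈ φ (A′ u w)) →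
    LK.IsSwitching v N A A′ → ∀ r → SameSpectrum (λ u w → C u w + r) (λ u w → C′ u w + r)
  similar {v = v} v-inj {N} NN⁻¹ N⁻¹N rows cols C≈A C′≈A′ S r =
    switching-sameSpectrum v v-inj (identity-map NN⁻¹) (identity-map N⁻¹N)
      (switching-shift v
        (λ i → ≈-trans (≈-sym (sum-homo (N i))) (≈-trans (⟦⟧-cong (rows i)) 1#-homo))
        (λ j → ≈-trans (≈-sym (sum-homo (λ i → N i j))) (≈-trans (⟦⟧-cong (cols j)) 1#-homo))
        (switching-map C≈A C′≈A′ S) r)

-- Sums and products of constant sequences are constant by computation, and `cauchy x` is the proof
-- that `x ≈ℝ x`.
fromℚ-homo : SemiringMorphisms.IsSemiringHomomorphism
  (Semiring.rawSemiring (CommutativeRing.semiring ℚ.+-*-commutativeRing))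
  (Semiring.rawSemiring (CommutativeRing.semiring ℝ-commutativeRing)) fromℚ
fromℚ-homo = record
  { isNearSemiringHomomorphism = record
    { +-isMonoidHomomorphism = record
      { isMagmaHomomorphism = record
        { isRelHomomorphism = record { cong = λ { {p} refl → cauchy (fromℚ p) } }
        ; homo = λ p q → cauchy (fromℚ (p ℚ.+ q))
        }
      ; ε-homo = cauchy (fromℚ 0ℚ)
      }
    ; *-homo = λ p q → cauchy (fromℚ (p ℚ.* q))
    }
  ; 1#-homo = cauchy (fromℚ 1ℚ)
  }

-- Planes and automorphisms of the cube

infixr 2 _⇔-dec_

_⇔-dec_ : ∀ {A B : Set} → Dec A → Dec B → Dec (A ⇔ B)
a? ⇔-dec b? = map′ (λ (f , g) → mk⇔ f g) (λ e → Equivalence.to e , Equivalence.from e)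
  ((a? →-dec b?) ×-dec (b? →-dec a?))

∀-Bool? : ∀ {P : Bool → Set} → (∀ b → Dec (P b)) → Dec (∀ b → P b)
∀-Bool? P? = map′ (λ { (f , t) false → f ; (f , t) true → t }) (λ h → h false , h true)
  (P? false ×-dec P? true)

∃-Bool? : ∀ {P : Bool → Set} → (∀ b → Dec (P b)) → Dec (∃[ b ] P b)
∃-Bool? P? = map′ [ false ,_ , true ,_ ]′ (λ { (false , p) → inj₁ p ; (true , p) → inj₂ p })
  (P? false ⊎-dec P? true)

comprehension : ∀ {n} {P : Fin n → Set} → (∀ i → Dec (P i)) → Subset n
comprehension P? = tabulate (does ∘ P?)

-- Turns a subset known only through its members into an explicit term with finitely many
-- parameters, whose properties can then be decided by running through these.
comprehension-unique : ∀ {n} {P : Fin n → Set} (P? : ∀ i → Dec (P i)) {S : Subset n} →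
                       (∀ i → i ∈ S ⇔ P i) → S ≡ comprehension P?
comprehension-unique P? {S} S⇔P = trans (sym (tabulate∘lookup S)) (tabulate-cong (λ i →
  trans (lookup≡does i) (does-⇔ (S⇔P i) (i ∈? S) (P? i))))
  where
  lookup≡does : ∀ i → lookup S i ≡ does (i ∈? S)
  lookup≡does i with i ∈? S
  ... | yes i∈S = []=⇒lookup i∈S
  ... | no  i∉S with lookup S i in eq
  ...   | true  = contradiction (lookup⇒[]= i S eq) i∉S
  ...   | false = refl

comprehension-⇔ : ∀ {n} {P : Fin n → Set} (P? : ∀ i → Dec (P i)) → ∀ i → i ∈ comprehension P? ⇔ P i
comprehension-⇔ P? i = mk⇔ to from
  where
  to : i ∈ comprehension P? → _
  to i∈ with P? i | trans (sym (lookup∘tabulate (does ∘ P?) i)) ([]=⇒lookup i∈)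
  ... | yes p | _ = p
  ... | no  _ | ()

  from : _ → i ∈ comprehension P?
  from p = lookup⇒[]= i _ (trans (lookup∘tabulate (does ∘ P?) i) (dec-true (P? i) p))

infix 4 _≟ʷ_

_≟ʷ_ : (w w′ : Vec Bool 3) → Dec (w ≡ w′)
_≟ʷ_ = ≡-dec Bool._≟_

face? : ∀ l b i → Dec (lookup (word i) l ≡ b)
face? l b i = lookup (word i) l Bool.≟ b

face : Fin 3 → Bool → Subset 8
face l b = comprehension (face? l b)

diagonal? : ∀ x y i → Dec (i ≡ x ⊎ i ≡ y ⊎ word i ≡ map not (word x) ⊎ word i ≡ map not (word y))
diagonal? x y i = i Fin.≟ x ⊎-dec i Fin.≟ y ⊎-dec word i ≟ʷ map not (word x) ⊎-dec word i ≟ʷ map not (word y)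

diagonalPlane : Fin 8 → Fin 8 → Subset 8
diagonalPlane x y = comprehension (diagonal? x y)

plane? : ∀ p a b i → Dec (word i ≡ p ⊎ word i ≡ p ⊕ a ⊎ word i ≡ p ⊕ b ⊎ word i ≡ p ⊕ a ⊕ b)
plane? p a b i = word i ≟ʷ p ⊎-dec word i ≟ʷ p ⊕ a ⊎-dec word i ≟ʷ p ⊕ b ⊎-dec word i ≟ʷ p ⊕ a ⊕ b

plane : (p a b : Vec Bool 3) → Subset 8
plane p a b = comprehension (plane? p a b)

parityPlane : Bool → Subset 8
parityPlane b = tabulate (λ i → foldr _ _xor_ b (word i))

CubeAdj? : ∀ i j → Dec (CubeAdj i j)
CubeAdj? i j = ∣ word i ⊕ word j ∣ ℕ.≟ 1

IsFace? : ∀ S → Dec (IsFace S)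
IsFace? S = Fin.any? λ l → ∃-Bool? λ b → Fin.all? λ i → i ∈? S ⇔-dec face? l b i

IsDiagonalPlane? : ∀ S → Dec (IsDiagonalPlane S)
IsDiagonalPlane? S = Fin.any? λ x → Fin.any? λ y → CubeAdj? x y ×-dec
  Fin.all? λ i → i ∈? S ⇔-dec diagonal? x y i

IsIndependentPlane? : ∀ S → Dec (IsIndependentPlane S)
IsIndependentPlane? S = ∣ S ∣ ℕ.≟ 4 ×-dec
  Fin.all? λ i → Fin.all? λ j → i ∈? S →-dec j ∈? S →-dec ¬? (CubeAdj? i j)

word-surjective : ∀ w → ∃[ i ] w ≡ word i
word-surjective (a ∷ b ∷ c ∷ []) = from-yes
  (∀-Bool? λ a → ∀-Bool? λ b → ∀-Bool? λ c → Fin.any? λ i → (a ∷ b ∷ c ∷ []) ≟ʷ word i) a b c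

-- Independence is what the switching rule speaks of, while N is evaluated on the explicit
-- `parityPlane b`; the third case carries both.
PlaneKind : Subset 8 → Set
PlaneKind S = IsFace S ⊎ IsDiagonalPlane S ⊎ (IsIndependentPlane S × ∃[ b ] S ≡ parityPlane b)

-- Each of `p`, `a`, `b` is the word of some point, so classifying the planes is a check on 512
-- triples of points.
affinePlane-kind : ∀ {S} → IsAffinePlane S → PlaneKind S
affinePlane-kind (p , a , b , a≢0 , b≢0 , a≢b , S⇔) rewrite comprehension-unique (plane? p a b) S⇔
  with word-surjective p | word-surjective a | word-surjective b
... | x , refl | y , refl | z , refl = table x y z a≢0 b≢0 a≢b
  where
  table : ∀ x y z → word y ≢ replicate 3 false → word z ≢ replicate 3 false → word y ≢ word z →
          PlaneKind (plane (word x) (word y) (word z))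
  table = from-yes (Fin.all? λ x → Fin.all? λ y → Fin.all? λ z →
    let S = plane (word x) (word y) (word z) in
    ¬? (word y ≟ʷ replicate 3 false) →-dec ¬? (word z ≟ʷ replicate 3 false) →-dec ¬? (word y ≟ʷ word z) →-dec
    (IsFace? S ⊎-dec IsDiagonalPlane? S ⊎-dec
     (IsIndependentPlane? S ×-dec ∃-Bool? λ b → ≡-dec Bool._≟_ S (parityPlane b))))

-- Unlike from-yes, this evaluates only the Boolean part of the decision.
by-evaluation : ∀ {a} {A : Set a} (a? : Dec A) → does a? ≡ true → A
by-evaluation (yes a) refl = a

-- Enumeration and conjugacy of the automorphisms of order six

Table : Set
Table = Vec (Fin 8) 8

module _ {m : ℕ} where

  Compatible : ℕ → Set₁
  Compatible n = Fin n → Fin n → Fin m → Fin m → Set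

  -- Compatibility is tested only for i < j, and the vectors are built from the
  -- last entry backwards.
  solutions : ∀ {n} {C : Compatible n} → (∀ i j x y → Dec (C i j x y)) → List (Vec (Fin m) n)
  solutions {zero}  C? = [] ∷ []
  solutions {suc n} C? = concatMap
    (λ xs → List.map (_∷ xs) (filter (λ x → Fin.all? λ j → C? zero (suc j) x (lookup xs j)) (allFin m)))
    (solutions (λ i j → C? (suc i) (suc j)))

  -- Completeness of the search is enough: later checks run over the whole list, so a spurious entry
  -- could only strengthen them, and each conjugator taken from it is verified by itself.
  ∈-solutions : ∀ {n} {C : Compatible n} (C? : ∀ i j x y → Dec (C i j x y)) (f : Fin n → Fin m) →
                (∀ i j → C i j (f i) (f j)) → tabulate f List.∈ solutions C?
  ∈-solutions {zero}  C? f f-ok = here refl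
  ∈-solutions {suc n} {C} C? f f-ok = ∈-concatMap⁺ _
    (Any.map (λ { refl → ∈-map⁺ (_∷ tabulate (f ∘ suc))
       (∈-filter⁺ _ (∈-allFin (f zero)) (λ j → subst (C zero (suc j) (f zero))
         (sym (lookup∘tabulate (f ∘ suc) j)) (f-ok zero (suc j)))) })
      (∈-solutions (λ i j → C? (suc i) (suc j)) (f ∘ suc) (λ i j → f-ok (suc i) (suc j))))

CubeCompatible? : ∀ i j x y → Dec (CubeAdj i j ⇔ CubeAdj x y)
CubeCompatible? i j x y = CubeAdj? i j ⇔-dec CubeAdj? x y

automorphisms : List Table
automorphisms = solutions CubeCompatible?

-- Every proper divisor of 6 divides 2 or 3, so excluding these two powers excludes all smaller
-- orders.
HasOrderSix : (Fin 8 → Fin 8) → Set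
HasOrderSix f = (∀ i → fold i f 6 ≡ i) × ¬ (∀ i → fold i f 2 ≡ i) × ¬ (∀ i → fold i f 3 ≡ i)

HasOrderSix? : ∀ f → Dec (HasOrderSix f)
HasOrderSix? f = is-power 6 ×-dec ¬? (is-power 2) ×-dec ¬? (is-power 3)
  where
  is-power : ∀ d → Dec (∀ i → fold i f d ≡ i)
  is-power d = Fin.all? λ i → fold i f d Fin.≟ i

sixfold : List Table
sixfold = filter (HasOrderSix? ∘ lookup) automorphisms

fold-cong : ∀ {f g : Fin 8 → Fin 8} → (∀ i → f i ≡ g i) → ∀ d i → fold i f d ≡ fold i g d
fold-cong f≗g zero    i = refl
fold-cong {f} {g} f≗g (suc d) i = trans (cong f (fold-cong f≗g d i)) (f≗g (fold i g d))

sixfold-table : ∀ π → IsCubeAutomorphism π → HasOrder π 6 →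
                ∃[ t ] (t List.∈ sixfold) × (∀ i → π ⟨$⟩ʳ i ≡ lookup t i)
sixfold-table π π-aut (π⁶ , minimal) = tabulate (π ⟨$⟩ʳ_) ,
  ∈-filter⁺ (HasOrderSix? ∘ lookup) (∈-solutions CubeCompatible? (π ⟨$⟩ʳ_) π-aut)
    ( (λ i → trans (sym (fold-cong π≗t 6 i)) (π⁶ i))
    , (λ t² → minimal 2 z<s (s<s (s<s z<s)) (λ i → trans (fold-cong π≗t 2 i) (t² i)))
    , (λ t³ → minimal 3 z<s (s<s (s<s (s<s z<s))) (λ i → trans (fold-cong π≗t 3 i) (t³ i)))) ,
  π≗t
  where
  π≗t : ∀ i → π ⟨$⟩ʳ i ≡ lookup (tabulate (π ⟨$⟩ʳ_)) i
  π≗t i = sym (lookup∘tabulate (π ⟨$⟩ʳ_) i)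

-- The inverse of an automorphism is an automorphism, so it is sought in the same list; exhibiting
-- it makes `g` a `Permutation′`.
Conjugates : List Table → Table → Table → Table → Set
Conjugates as t t′ g = (∀ i → lookup g (lookup t i) ≡ lookup t′ (lookup g i)) ×
  (∀ i j → CubeAdj i j ⇔ CubeAdj (lookup g i) (lookup g j)) ×
  Any (λ h → (∀ i → lookup g (lookup h i) ≡ i) × (∀ i → lookup h (lookup g i) ≡ i)) as

Conjugates? : ∀ as t t′ g → Dec (Conjugates as t t′ g)
Conjugates? as t t′ g =
  (Fin.all? λ i → lookup g (lookup t i) Fin.≟ lookup t′ (lookup g i)) ×-dec
  (Fin.all? λ i → Fin.all? λ j → CubeCompatible? i j (lookup g i) (lookup g j)) ×-dec
  Any.any? (λ h → (Fin.all? λ i → lookup g (lookup h i) Fin.≟ i) ×-dec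
                  (Fin.all? λ i → lookup h (lookup g i) Fin.≟ i)) as

AllConjugate? : ∀ as ts → Dec (All (λ t → All (λ t′ → Any (Conjugates as t t′) as) ts) ts)
AllConjugate? as ts = All.all? (λ t → All.all? (λ t′ → Any.any? (Conjugates? as t t′) as) ts) ts

sixfold-conjugate : All (λ t → All (λ t′ → Any (Conjugates automorphisms t t′) automorphisms) sixfold) sixfold
sixfold-conjugate = by-evaluation (AllConjugate? automorphisms sixfold) refl

-- Stated for arbitrary lists, lest the type checker unfold the two enumerations.
conjugate-in : ∀ as ts → All (λ t → All (λ t′ → Any (Conjugates as t t′) as) ts) ts →
  ∀ (π π′ : Permutation′ 8) →
  ∃[ t ] (t List.∈ ts) × (∀ i → π ⟨$⟩ʳ i ≡ lookup t i) →
  ∃[ t ] (t List.∈ ts) × (∀ i → π′ ⟨$⟩ʳ i ≡ lookup t i) →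
  ∃[ g ] IsCubeAutomorphism g × (∀ i → g ⟨$⟩ʳ (π ⟨$⟩ʳ i) ≡ π′ ⟨$⟩ʳ (g ⟨$⟩ʳ i))
conjugate-in as ts all-conjugate π π′ (t , t∈ , π≗t) (t′ , t′∈ , π′≗t′)
  with Any.satisfied (All.lookup (All.lookup all-conjugate t∈) t′∈)
... | g , g-conj , g-aut , ∃h with Any.satisfied ∃h
... | h , gh , hg = permutation (lookup g) (lookup h) gh hg , g-aut , λ i →
  trans (cong (lookup g) (π≗t i)) (trans (g-conj i) (sym (π′≗t′ (lookup g i))))

conjugate : ∀ (π π′ : Permutation′ 8) →
  IsCubeAutomorphism π → HasOrder π 6 → IsCubeAutomorphism π′ → HasOrder π′ 6 →
  ∃[ g ] IsCubeAutomorphism g × (∀ i → g ⟨$⟩ʳ (π ⟨$⟩ʳ i) ≡ π′ ⟨$⟩ʳ (g ⟨$⟩ʳ i))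
conjugate π π′ π-aut π-six π′-aut π′-six = conjugate-in automorphisms sixfold sixfold-conjugate π π′
  (sixfold-table π π-aut π-six) (sixfold-table π′ π′-aut π′-six)

-- The operators N, over the rationals

open Matrices ℚ.+-*-commutativeRing
open LinearAlgebra ℚ.+-*-commutativeRing
open IsLinear
open SemiringSum (CommutativeRing.semiring ℚ.+-*-commutativeRing)
open ≡-Reasoning

-- Passing a matrix through memo makes the type checker evaluate each entry only once.
memo : ∀ {m n} → Matrix m n → Vec (Vec ℚ n) m
memo M = tabulate (λ i → tabulate (M i))

entry : ∀ {m n} → Vec (Vec ℚ n) m → Matrix m n
entry T i j = lookup (lookup T i) j

entry-memo : ∀ {m n} (M : Matrix m n) i j → entry (memo M) i j ≡ M i j
entry-memo M i j = trans (cong (λ row → lookup row j) (lookup∘tabulate _ i)) (lookup∘tabulate (M i) j)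

χ : Subset 8 → Fin 8 → ℚ
χ S i = ⟦ lookup S i ⟧

-- With A the antipodal map, P the permutation operator of π and χ the parity
-- character (so P χ = -χ), N is P (1 - A) / 2 - (1 + A) / 2 corrected by twice
-- the projections J / 8 and χ χᵀ / 8, where (J + χ χᵀ) / 2 indicates equal parity.
rotation : Table → Matrix 8 8
rotation t i j = ½ ℚ.* (⟦ does (parity i Bool.≟ parity j) ⟧
  ℚ.- ⟦ does (i Fin.≟ j) ⟧ ℚ.- ⟦ does (antipodal? i j) ⟧
  ℚ.+ ⟦ does (i Fin.≟ lookup t j) ⟧ ℚ.- ⟦ does (antipodal? i (lookup t j)) ⟧)
  where
  parity : Fin 8 → Bool
  parity i = foldr _ _xor_ false (word i)

  antipodal? : ∀ i j → Dec (word i ≡ map not (word j))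
  antipodal? i j = word i ≟ʷ map not (word j)

blockMatrix : Fin 40 → Matrix 8 8
blockMatrix k i j = ⟦ B k i j ⟧

record ActsAs (t : Table) (N : Matrix 8 8) : Set where
  field
    N⊗Nᵀ     : IsIdentity (N ⊗ N ᵀ)
    Nᵀ⊗N     : IsIdentity (N ᵀ ⊗ N)
    rows     : ∀ i → sum (N i) ≡ 1ℚ
    columns  : ∀ j → sum (λ i → N i j) ≡ 1ℚ
    faces    : ∀ l b j → (N ⊗ᵥ χ (face l b)) (lookup t j) ≡ χ (face l b) j
    -- The faces above are evaluated at `lookup t j`, which avoids inverting the table.
    diagonal : ∀ x y → CubeAdj x y → ∀ i →
               (N ⊗ᵥ χ (diagonalPlane x y)) i ≡ ⟦ not (lookup (diagonalPlane x y) i) ⟧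
    parity   : ∀ b i → (N ⊗ᵥ χ (parityPlane b)) i ≡ χ (parityPlane b) i
    -- These five are Cayley graphs on the group of words, so the characters are eigenvectors. The
    -- three of degree one share an eigenvalue (0, 1, -1, 0, -1 respectively), and N is a scalar on
    -- each of its other pieces.
    B-comm   : ∀ k → toℕ k < 5 → ∀ i j → (blockMatrix k ⊗ N) i j ≡ (N ⊗ blockMatrix k) i j
    -- An automorphism is determined by the images of the faces, so at most one table satisfies the
    -- premise.
    unique   : (∀ l b j → (R-cube ᵀ ⊗ᵥ χ (face l b)) (lookup t j) ≡ χ (face l b) j) →
               ∀ i j → R-cube j i ≡ N i j

IsIdentity? : ∀ {n} (M : Matrix n n) → Dec (IsIdentity M)
IsIdentity? M = Fin.all? λ i → Fin.all? λ j → _ ℚ.≟ _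

ActsAs? : ∀ t N → Dec (ActsAs t N)
ActsAs? t N = map′
  (λ (a , b , c , d , e , f , g , h , i) → record
    { N⊗Nᵀ = a ; Nᵀ⊗N = b ; rows = c ; columns = d ; faces = e
    ; diagonal = f ; parity = g ; B-comm = h ; unique = i })
  (λ r → let open ActsAs r in
    N⊗Nᵀ , Nᵀ⊗N , rows , columns , faces , diagonal , parity , B-comm , unique)
  (IsIdentity? (N ⊗ N ᵀ) ×-dec
   IsIdentity? (N ᵀ ⊗ N) ×-dec
   (Fin.all? λ i → _ ℚ.≟ _) ×-dec
   (Fin.all? λ j → _ ℚ.≟ _) ×-dec
   (Fin.all? λ l → ∀-Bool? λ b → Fin.all? λ j → _ ℚ.≟ _) ×-dec
   (Fin.all? λ x → Fin.all? λ y → CubeAdj? x y →-dec Fin.all? λ i → _ ℚ.≟ _) ×-dec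
   (∀-Bool? λ b → Fin.all? λ i → _ ℚ.≟ _) ×-dec
   (Fin.all? λ k → toℕ k ℕ.<? 5 →-dec Fin.all? λ i → Fin.all? λ j → _ ℚ.≟ _) ×-dec
   ((Fin.all? λ l → ∀-Bool? λ b → Fin.all? λ j → _ ℚ.≟ _) →-dec
    Fin.all? λ i → Fin.all? λ j → _ ℚ.≟ _))

rotation-acts : All (λ t → ActsAs t (entry (memo (rotation t)))) sixfold
rotation-acts = by-evaluation (All.all? (λ t → ActsAs? t (entry (memo (rotation t)))) sixfold) refl

IsAdjacency : ∀ {n} → Matrix n n → Set
IsAdjacency M = ∀ i j → M i j ≡ M j i × (M i j ≡ 0ℚ ⊎ M i j ≡ 1ℚ × i ≢ j)

IsAdjacency? : ∀ {n} (M : Matrix n n) → Dec (IsAdjacency M)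
IsAdjacency? M = Fin.all? λ i → Fin.all? λ j → M i j ℚ.≟ M j i ×-dec
  (M i j ℚ.≟ 0ℚ ⊎-dec M i j ℚ.≟ 1ℚ ×-dec ¬? (i Fin.≟ j))

-- Every intermediate product is tabulated; `product` takes the tabulated matrix as an argument so
-- that both factors share it.
congruent : ∀ {n} → Matrix n n → Matrix n n → Matrix n n
congruent R X = product (entry (memo R))
  where
  product : Matrix _ _ → Matrix _ _
  product R = entry (memo (entry (memo (R ᵀ ⊗ entry (memo X))) ⊗ R))

congruent-product : ∀ {n} (R X : Matrix n n) i j → congruent R X i j ≡ (R ᵀ ⊗ X ⊗ R) i j
congruent-product R X i j = trans (entry-memo _ i j)
  (⊗ᵥ-cong
    (λ p q → trans (entry-memo _ p q)
      (⊗ᵥ-cong (λ a b → entry-memo R b a) (λ b → entry-memo X b q) p))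
    (λ q → entry-memo R q j) i)

switchedBlock : Fin 40 → Matrix 8 8
switchedBlock k = congruent R-cube (blockMatrix k)

-- Orthogonality alone does not force RᵀBR to be a 0/1 matrix with zero diagonal. This is a property
-- of the listed graphs, and it is what makes the replaced block a graph.
switchedBlock-adjacency : ∀ k → IsAdjacency (switchedBlock k)
switchedBlock-adjacency = by-evaluation (Fin.all? λ k → IsAdjacency? (switchedBlock k)) refl

adjacencyGraph : ∀ {n} (M : Matrix n n) → IsAdjacency M →
                 ∃[ G ] (∀ i j → ⟦ adj {n} G i j ⟧ ≡ M i j)
adjacencyGraph M M-ok = record
  { adj      = λ i j → does (M i j ℚ.≟ 1ℚ)
  ; symm     = λ i j → cong (λ q → does (q ℚ.≟ 1ℚ)) (proj₁ (M-ok i j))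
  ; loopless = λ i → [ cong (λ q → does (q ℚ.≟ 1ℚ)) , (λ (_ , i≢i) → contradiction refl i≢i) ]′
                       (proj₂ (M-ok i i))
  } , λ i j → [ indicator-of false , (λ (eq , _) → indicator-of true eq) ]′ (proj₂ (M-ok i j))
  where
  indicator-of : ∀ b {q} → q ≡ ⟦ b ⟧ → ⟦ does (q ℚ.≟ 1ℚ) ⟧ ≡ q
  indicator-of false refl = refl
  indicator-of true  refl = refl

-- Traces under the operator N

ActsOn : Permutation′ 8 → Matrix 8 8 → Set
ActsOn π N = ∃[ t ] ActsAs t N × (∀ i → π ⟨$⟩ʳ i ≡ lookup t i)

-- As in `conjugate-in`, the list is a variable, so the enumeration stays folded.
rotation-exists : ∀ ts → All (λ t → ActsAs t (entry (memo (rotation t)))) ts →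
  ∀ π → ∃[ t ] (t List.∈ ts) × (∀ i → π ⟨$⟩ʳ i ≡ lookup t i) → ∃[ N ] ActsOn π N
rotation-exists ts acts π (t , t∈ts , π≗t) = _ , t , All.lookup acts t∈ts , π≗t

lookup-image : ∀ π S i → lookup (image π S) i ≡ lookup S (π ⟨$⟩ˡ i)
lookup-image π S = lookup∘tabulate (λ i → lookup S (π ⟨$⟩ˡ i))

-- `RealisedByR-cube` prescribes the matrix only on faces, which span a space of dimension four;
-- agreement with `N` everywhere comes from the evaluated implication `unique`.
realised : ∀ π N → ActsOn π N → RealisedByR-cube π → ∀ i j → R-cube j i ≡ N i j
realised π N (t , acts , π≗t) real = ActsAs.unique acts λ l b j → begin
  (R-cube ᵀ ⊗ᵥ χ (face l b)) (lookup t j)   ≡⟨ real (face l b) (l , b , comprehension-⇔ (face? l b)) (lookup t j) ⟩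
  χ (image π (face l b)) (lookup t j)       ≡⟨ cong (χ (image π (face l b))) (π≗t j) ⟨
  χ (image π (face l b)) (π ⟨$⟩ʳ j)         ≡⟨ cong ⟦_⟧ (lookup-image π (face l b) (π ⟨$⟩ʳ j)) ⟩
  χ (face l b) (π ⟨$⟩ˡ (π ⟨$⟩ʳ j))          ≡⟨ cong (χ (face l b)) (Perm.inverseˡ π) ⟩
  χ (face l b) j                            ∎

-- The rule is separated from graphs because it serves twice: it is extracted from any given `Γ′`,
-- and it is proved of `switchTrace` to construct one.
record SwitchesTo (π : Permutation′ 8) (S S′ : Subset 8) : Set where
  field
    onTrivial     : S ≡ ⊤ ⊎ S ≡ ⊥ → S′ ≡ S
    onFace        : IsFace S → S′ ≡ image π S
    onDiagonal    : IsDiagonalPlane S → S′ ≡ ∁ S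
    onIndependent : IsIndependentPlane S → S′ ≡ S

⊗ᵥ-switches : ∀ {π N S S′} → ActsOn π N → SwitchesTo π S S′ →
  S ≡ ⊤ ⊎ S ≡ ⊥ ⊎ IsAffinePlane S → ∀ i → χ S′ i ≡ (N ⊗ᵥ χ S) i
⊗ᵥ-switches {π} {N} {S} {S′} (t , acts , π≗t) sw = switch
  where
  open ActsAs acts
  module sw = SwitchesTo sw

  at : ∀ {S₁ S₂} → S₁ ≡ S₂ → ∀ i → χ S₁ i ≡ χ S₂ i
  at eq i = cong (λ T → χ T i) eq

  on-kind : PlaneKind S → ∀ i → χ S′ i ≡ (N ⊗ᵥ χ S) i
  on-kind (inj₁ (l , b , S⇔)) i with comprehension-unique (face? l b) S⇔
  ... | refl = begin
    χ S′ i                                     ≡⟨ at (sw.onFace (l , b , S⇔)) i ⟩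
    χ (image π (face l b)) i                   ≡⟨ cong ⟦_⟧ (lookup-image π (face l b) i) ⟩
    -- `faces` concerns points of the form `lookup t j`, so `i` is written as the image of
    -- `π ⟨$⟩ˡ i`.
    χ (face l b) (π ⟨$⟩ˡ i)                    ≡⟨ faces l b (π ⟨$⟩ˡ i) ⟨
    (N ⊗ᵥ χ (face l b)) (lookup t (π ⟨$⟩ˡ i))  ≡⟨ cong (N ⊗ᵥ χ (face l b)) (π≗t (π ⟨$⟩ˡ i)) ⟨
    (N ⊗ᵥ χ (face l b)) (π ⟨$⟩ʳ (π ⟨$⟩ˡ i))    ≡⟨ cong (N ⊗ᵥ χ (face l b)) (Perm.inverseʳ π) ⟩
    (N ⊗ᵥ χ (face l b)) i                      ∎
  on-kind (inj₂ (inj₁ (x , y , xy , S⇔))) i with comprehension-unique (diagonal? x y) S⇔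
  ... | refl = begin
    χ S′ i                                     ≡⟨ at (sw.onDiagonal (x , y , xy , S⇔)) i ⟩
    χ (∁ (diagonalPlane x y)) i                ≡⟨ cong ⟦_⟧ (lookup-map i not (diagonalPlane x y)) ⟩
    ⟦ not (lookup (diagonalPlane x y) i) ⟧     ≡⟨ diagonal x y xy i ⟨
    (N ⊗ᵥ χ (diagonalPlane x y)) i             ∎
  on-kind (inj₂ (inj₂ (ind , b , S≡))) i = begin
    χ S′ i                      ≡⟨ at (trans (sw.onIndependent ind) S≡) i ⟩
    χ (parityPlane b) i         ≡⟨ parity b i ⟨
    (N ⊗ᵥ χ (parityPlane b)) i  ≡⟨ cong (λ T → (N ⊗ᵥ χ T) i) S≡ ⟨
    (N ⊗ᵥ χ S) i                ∎

  switch : S ≡ ⊤ ⊎ S ≡ ⊥ ⊎ IsAffinePlane S → ∀ i → χ S′ i ≡ (N ⊗ᵥ χ S) i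
  switch (inj₁ refl) i = begin
    χ S′ i                  ≡⟨ at (sw.onTrivial (inj₁ refl)) i ⟩
    χ ⊤ i                   ≡⟨ cong ⟦_⟧ (lookup-replicate i true) ⟩
    1ℚ                      ≡⟨ rows i ⟨
    sum (N i)               ≡⟨ sum-cong-≗ (λ j → trans (cong (λ b → N i j ℚ.* ⟦ b ⟧) (lookup-replicate j true))
                                                       (ℚ.*-identityʳ (N i j))) ⟨
    (N ⊗ᵥ χ ⊤) i            ∎
  switch (inj₂ (inj₁ refl)) i = begin
    χ S′ i                  ≡⟨ at (sw.onTrivial (inj₂ refl)) i ⟩
    χ ⊥ i                   ≡⟨ cong ⟦_⟧ (lookup-replicate i false) ⟩
    0ℚ                      ≡⟨ Q-zero (⊗ᵥ-linear N) (χ ⊥) (λ j → cong ⟦_⟧ (lookup-replicate j false)) i ⟨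
    (N ⊗ᵥ χ ⊥) i            ∎
  switch (inj₂ (inj₂ affine)) = on-kind (affinePlane-kind affine)

-- Intertwining relations on the block

congruent-cong : ∀ {n} (R : Matrix n n) {X Y : Matrix n n} → (∀ i j → X i j ≡ Y i j) →
                 ∀ i j → (R ᵀ ⊗ X ⊗ R) i j ≡ (R ᵀ ⊗ Y ⊗ R) i j
congruent-cong R X≗Y i j =
  ⊗ᵥ-cong (λ p q → Q-cong (⊗ᵥ-linear (R ᵀ)) (λ r → X≗Y r q) p) (λ _ → refl) i

-- Since Rᵀ = N, orthogonality gives X′N = NXNᵀN = NX.
congruent-intertwines : ∀ {n} {R N X X′ : Matrix n n} → IsIdentity (N ᵀ ⊗ N) → (∀ i j → R j i ≡ N i j) →
  (∀ i j → X′ i j ≡ (R ᵀ ⊗ X ⊗ R) i j) → ∀ i j → (X′ ⊗ N) i j ≡ (N ⊗ X) i j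
congruent-intertwines {R = R} {N} {X} {X′} NᵀN≡1 R≡N X′≡ i j = begin
  (X′ ⊗ N) i j
    ≡⟨ ⊗ᵥ-cong (λ p q → trans (X′≡ p q) (⊗ᵥ-cong
         (λ a b → ⊗ᵥ-cong (λ c d → R≡N c d) (λ _ → refl) a) (λ b → R≡N q b) p)) (λ _ → refl) i ⟩
  (N ⊗ X ⊗ N ᵀ ⊗ N) i j
    ≡⟨ ⊗ᵥ-assoc (N ⊗ X) (N ᵀ) (λ k → N k j) i ⟩
  ((N ⊗ X) ⊗ᵥ (λ k → (N ᵀ ⊗ N) k j)) i
    ≡⟨ Q-cong (⊗ᵥ-linear (N ⊗ X)) (λ k → NᵀN≡1 k j) i ⟩
  ((N ⊗ X) ⊗ᵥ (λ k → ⟦ does (k Fin.≟ j) ⟧)) i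
    ≡⟨ sum-cong-≗ (λ k → ℚ.*-comm ((N ⊗ X) i k) ⟦ does (k Fin.≟ j) ⟧) ⟩
  sum (λ k → ⟦ does (k Fin.≟ j) ⟧ ℚ.* (N ⊗ X) i k)
    ≡⟨ indicator-sum′ j ((N ⊗ X) i) ⟩
  (N ⊗ X) i j ∎

commuting-intertwines : ∀ {n} {N X X′ Y : Matrix n n} → (∀ i j → X i j ≡ Y i j) → (∀ i j → X′ i j ≡ Y i j) →
  (∀ i j → (Y ⊗ N) i j ≡ (N ⊗ Y) i j) → ∀ i j → (X′ ⊗ N) i j ≡ (N ⊗ X) i j
commuting-intertwines {N = N} {X} {X′} {Y} X≗Y X′≗Y YN≗NY i j = begin
  (X′ ⊗ N) i j  ≡⟨ ⊗ᵥ-cong X′≗Y (λ _ → refl) i ⟩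
  (Y ⊗ N) i j   ≡⟨ YN≗NY i j ⟩
  (N ⊗ Y) i j   ≡⟨ Q-cong (⊗ᵥ-linear N) (λ q → X≗Y q j) i ⟨
  (N ⊗ X) i j   ∎

-- From traces and block to cospectrality

indicatorMatrix : ∀ {n} → Graph n → Matrix n n
indicatorMatrix Γ u w = ⟦ adj Γ u w ⟧

-- One trace condition yields both off-diagonal blocks: `col` by symmetry of adjacency, and `row`
-- because (Na)ᵀN = aᵀ.
graph-switching : ∀ {m n} (Γ Γ′ : Graph n) (v : Fin m → Fin n) {N : Matrix m m} → IsIdentity (N ᵀ ⊗ N) →
  (∀ u w → (∀ i → u ≢ v i) → (∀ i → w ≢ v i) → adj Γ′ u w ≡ adj Γ u w) →
  (∀ u → (∀ i → u ≢ v i) → ∀ i → ⟦ adj Γ′ u (v i) ⟧ ≡ (N ⊗ᵥ (λ j → ⟦ adj Γ u (v j) ⟧)) i) →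
  (∀ i j → ((λ p q → ⟦ adj Γ′ (v p) (v q) ⟧) ⊗ N) i j ≡ (N ⊗ (λ p q → ⟦ adj Γ (v p) (v q) ⟧)) i j) →
  IsSwitching v N (indicatorMatrix Γ) (indicatorMatrix Γ′)
graph-switching Γ Γ′ v {N} NᵀN≡1 same across block = record
  { rest  = λ u w out-u out-w → cong ⟦_⟧ (same u w out-u out-w)
  ; row   = λ u out j → begin
      sum (λ i → ⟦ adj Γ′ u (v i) ⟧ ℚ.* N i j)
        ≡⟨ sum-cong-≗ (λ i → trans (cong (ℚ._* N i j) (across u out i)) (ℚ.*-comm _ (N i j))) ⟩
      (N ᵀ ⊗ᵥ (N ⊗ᵥ (λ i → ⟦ adj Γ u (v i) ⟧))) j
        ≡⟨ ⊗ᵥ-assoc (N ᵀ) N _ j ⟨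
      ((N ᵀ ⊗ N) ⊗ᵥ (λ i → ⟦ adj Γ u (v i) ⟧)) j
        ≡⟨ ⊗ᵥ-identity NᵀN≡1 _ j ⟩
      ⟦ adj Γ u (v j) ⟧ ∎
  ; col   = λ w out i → begin
      ⟦ adj Γ′ (v i) w ⟧                    ≡⟨ cong ⟦_⟧ (symm Γ′ (v i) w) ⟩
      ⟦ adj Γ′ w (v i) ⟧                    ≡⟨ across w out i ⟩
      (N ⊗ᵥ (λ j → ⟦ adj Γ w (v j) ⟧)) i    ≡⟨ Q-cong (⊗ᵥ-linear N) (λ j → cong ⟦_⟧ (symm Γ w (v j))) i ⟩
      (N ⊗ᵥ (λ j → ⟦ adj Γ (v j) w ⟧)) i    ∎
  ; block = block
  }

module _ {n} (Γ Γ′ : Graph n) (v : Fin 8 → Fin n) (k : Fin 40) (π : Permutation′ 8)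
         (switching : IsSwitchingSet Γ v k) (real : 5 ≤ toℕ k → RealisedByR-cube π)
         (switched : IsSwitched Γ v k π Γ′) where
  private
    module switching = IsSwitchingSet switching
    module switched = IsSwitched switched

  trace-entry : ∀ (G : Graph n) u i → χ (trace G v u) i ≡ ⟦ adj G u (v i) ⟧
  trace-entry G u i = cong ⟦_⟧ (lookup∘tabulate (λ i → adj G u (v i)) i)

  isSwitching : ∀ {N} → ActsOn π N → IsSwitching v N (indicatorMatrix Γ) (indicatorMatrix Γ′)
  isSwitching {N} on@(t , acts , _) = graph-switching Γ Γ′ v Nᵀ⊗N switched.rest trace-switched on-block
    where
    open ActsAs acts

    trace-switched : ∀ u → Outside v u → ∀ i → ⟦ adj Γ′ u (v i) ⟧ ≡ (N ⊗ᵥ (λ j → ⟦ adj Γ u (v j) ⟧)) i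
    trace-switched u out i = begin
      ⟦ adj Γ′ u (v i) ⟧                   ≡⟨ trace-entry Γ′ u i ⟨
      χ (trace Γ′ v u) i                   ≡⟨ ⊗ᵥ-switches {π} {N} on switches (switching.traces u out) i ⟩
      (N ⊗ᵥ χ (trace Γ v u)) i             ≡⟨ Q-cong (⊗ᵥ-linear N) (trace-entry Γ u) i ⟩
      (N ⊗ᵥ (λ j → ⟦ adj Γ u (v j) ⟧)) i   ∎
      where
      switches : SwitchesTo π (trace Γ v u) (trace Γ′ v u)
      switches = record
        { onTrivial  = switched.trivial u out
        ; onFace = switched.face u out
        ; onDiagonal = switched.diagonal u out
        ; onIndependent = switched.independent u out
        }

    block block′ : Matrix 8 8
    block p q  = ⟦ adj Γ (v p) (v q) ⟧
    block′ p q = ⟦ adj Γ′ (v p) (v q) ⟧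

    block≡B : ∀ p q → block p q ≡ blockMatrix k p q
    block≡B p q = cong ⟦_⟧ (switching.induced p q)

    on-block : ∀ i j → (block′ ⊗ N) i j ≡ (N ⊗ block) i j
    -- Index 5 is the sixth graph: from there on the block is conjugated by `R-cube`, and `real`
    -- identifies that matrix with the transpose of `N`.
    on-block with toℕ k ℕ.<? 5
    ... | yes k<5 = commuting-intertwines {N = N} {block} {block′} {blockMatrix k} block≡B
      (λ p q → trans (cong ⟦_⟧ (switched.B₁-B₅ k<5 p q)) (block≡B p q)) (B-comm k k<5)
    ... | no k≮5 = congruent-intertwines {R = R-cube} {N} {block} {block′}
      Nᵀ⊗N (realised π N on (real 5≤k)) (switched.B₆-B₄₀ 5≤k)
      where
      5≤k : 5 ≤ toℕ k
      5≤k = ℕ.≮⇒≥ k≮5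

switching-cospectral : ∀ {m n} (Γ Γ′ : Graph n) (v : Fin m → Fin n) → Injective _≡_ _≡_ v →
  (N : Matrix m m) → IsIdentity (N ⊗ N ᵀ) → IsIdentity (N ᵀ ⊗ N) →
  (∀ i → sum (N i) ≡ 1ℚ) → (∀ j → sum (λ i → N i j) ≡ 1ℚ) →
  IsSwitching v N (indicatorMatrix Γ) (indicatorMatrix Γ′) → ℝ-Cospectral Γ Γ′
switching-cospectral Γ Γ′ v v-inj N NNᵀ≡1 NᵀN≡1 rows columns S =
  similar {v = v} v-inj {N = N} {N ᵀ} {indicatorMatrix Γ} {indicatorMatrix Γ′}
    {λ u w → Matrices.⟦_⟧ ℝ-commutativeRing (adj Γ u w)} {λ u w → Matrices.⟦_⟧ ℝ-commutativeRing (adj Γ′ u w)}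
    NNᵀ≡1 NᵀN≡1 rows columns
    (λ u w → ⟦⟧-homo (adj Γ u w)) (λ u w → ⟦⟧-homo (adj Γ′ u w)) S
  where open Transport ℚ.+-*-commutativeRing ℝ-commutativeRing fromℚ fromℚ-homo

cospectral : ∀ {n} (Γ : Graph n) (v : Fin 8 → Fin n) → Injective _≡_ _≡_ v →
  ∀ k → IsSwitchingSet Γ v k → ∀ π → ∃[ N ] ActsOn π N → (5 ≤ toℕ k → RealisedByR-cube π) →
  ∀ Γ′ → IsSwitched Γ v k π Γ′ → ℝ-Cospectral Γ Γ′
cospectral Γ v v-inj k switching π (N , on@(_ , acts , _)) real Γ′ switched =
  switching-cospectral Γ Γ′ v v-inj N N⊗Nᵀ Nᵀ⊗N rows columns
    (isSwitching Γ Γ′ v k π switching real switched on)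
  where open ActsAs acts

-- The switched graph

select : {A : Set} → Dec A → Subset 8 → Subset 8 → Subset 8
select a? S S′ = if does a? then S else S′

select-yes : ∀ {A} (a? : Dec A) {S S′} → A → select a? S S′ ≡ S
select-yes a? {S} {S′} a = cong (λ b → if b then S else S′) (dec-true a? a)

select-no : ∀ {A} (a? : Dec A) {S S′} → ¬ A → select a? S S′ ≡ S′
select-no a? {S} {S′} ¬a = cong (λ b → if b then S else S′) (dec-false a? ¬a)

-- The default branch covers `⊤`, `⊥` and the independent planes. The order of the tests is harmless
-- because the three kinds of plane are disjoint, as shown next.
switchTrace : Permutation′ 8 → Subset 8 → Subset 8
switchTrace π S = select (IsFace? S) (image π S) (select (IsDiagonalPlane? S) (∁ S) S)

switchTrace-face : ∀ π {S} → IsFace S → switchTrace π S ≡ image π S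
switchTrace-face π {S} = select-yes (IsFace? S)

switchTrace-diagonal : ∀ π {S} → ¬ IsFace S → IsDiagonalPlane S → switchTrace π S ≡ ∁ S
switchTrace-diagonal π {S} ¬face S-diagonal =
  trans (select-no (IsFace? S) ¬face) (select-yes (IsDiagonalPlane? S) S-diagonal)

switchTrace-other : ∀ π {S} → ¬ IsFace S → ¬ IsDiagonalPlane S → switchTrace π S ≡ S
switchTrace-other π {S} ¬face ¬diagonal =
  trans (select-no (IsFace? S) ¬face) (select-no (IsDiagonalPlane? S) ¬diagonal)

diagonal⇒¬face : ∀ {S} → IsDiagonalPlane S → ¬ IsFace S
diagonal⇒¬face (x , y , xy , S⇔) S-face =
  table x y xy (subst IsFace (comprehension-unique (diagonal? x y) S⇔) S-face)
  where
  table : ∀ x y → CubeAdj x y → ¬ IsFace (diagonalPlane x y)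
  table = from-yes (Fin.all? λ x → Fin.all? λ y → CubeAdj? x y →-dec ¬? (IsFace? (diagonalPlane x y)))

independent⇒¬face : ∀ {S} → IsIndependentPlane S → ¬ IsFace S
independent⇒¬face S-independent (l , b , S⇔) =
  table l b (subst IsIndependentPlane (comprehension-unique (face? l b) S⇔) S-independent)
  where
  table : ∀ l b → ¬ IsIndependentPlane (face l b)
  table = from-yes (Fin.all? λ l → ∀-Bool? λ b → ¬? (IsIndependentPlane? (face l b)))

independent⇒¬diagonal : ∀ {S} → IsIndependentPlane S → ¬ IsDiagonalPlane S
independent⇒¬diagonal (_ , independent) (x , y , xy , S⇔) = independent x y
  (Equivalence.from (S⇔ x) (inj₁ refl)) (Equivalence.from (S⇔ y) (inj₂ (inj₁ refl))) xy

switchTrace-correct : ∀ π S → SwitchesTo π S (switchTrace π S)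
switchTrace-correct π S = record
  { onTrivial     = λ { (inj₁ refl) → switchTrace-other π (from-no (IsFace? ⊤)) (from-no (IsDiagonalPlane? ⊤))
                      ; (inj₂ refl) → switchTrace-other π (from-no (IsFace? ⊥)) (from-no (IsDiagonalPlane? ⊥)) }
  ; onFace        = switchTrace-face π
  ; onDiagonal    = λ d → switchTrace-diagonal π (diagonal⇒¬face d) d
  ; onIndependent = λ i → switchTrace-other π (independent⇒¬face i) (independent⇒¬diagonal i)
  }

module _ {n} (Γ : Graph n) (v : Fin 8 → Fin n) (v-injective : Injective _≡_ _≡_ v)
         (C : Graph 8) (σ : Subset 8 → Subset 8) where

  -- Taking the two decisions as arguments lets symmetry and looplessness be proved by cases on
  -- them. Both mixed cases read the trace of the outer vertex, which makes them symmetric by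
  -- computation.
  replacedAdj : ∀ {u w} → Dec (∃[ i ] u ≡ v i) → Dec (∃[ j ] w ≡ v j) → Bool
  replacedAdj         (yes (i , _)) (yes (j , _)) = adj C i j
  replacedAdj {w = w} (yes (i , _)) (no _)        = lookup (σ (trace Γ v w)) i
  replacedAdj {u}     (no _)        (yes (j , _)) = lookup (σ (trace Γ v u)) j
  replacedAdj {u} {w} (no _)        (no _)        = adj Γ u w

  replaced : Graph n
  replaced = record
    { adj      = λ u w → replacedAdj (position? v u) (position? v w)
    ; symm     = λ u w → replaced-symm (position? v u) (position? v w)
    ; loopless = λ u → replaced-loopless (position? v u)
    }
    where
    replaced-symm : ∀ {u w} p q → replacedAdj {u} {w} p q ≡ replacedAdj q p
    replaced-symm (yes (i , _)) (yes (j , _)) = symm C i j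
    replaced-symm (yes _)       (no _)        = refl
    replaced-symm (no _)        (yes _)       = refl
    replaced-symm {u} {w} (no _) (no _)       = symm Γ u w

    replaced-loopless : ∀ {u} p → replacedAdj {u} {u} p p ≡ false
    replaced-loopless     (yes (i , _)) = loopless C i
    replaced-loopless {u} (no _)        = loopless Γ u

  replaced-inside : ∀ i j → adj replaced (v i) (v j) ≡ adj C i j
  replaced-inside i j with position? v (v i) | position? v (v j)
  ... | yes (_ , p) | yes (_ , q) = cong₂ (adj C) (v-injective (sym p)) (v-injective (sym q))
  ... | no ¬p       | _           = contradiction (i , refl) ¬p
  ... | yes _       | no ¬q       = contradiction (j , refl) ¬q

  replaced-across : ∀ u → Outside v u → ∀ i → adj replaced u (v i) ≡ lookup (σ (trace Γ v u)) i
  replaced-across u out i with position? v u | position? v (v i)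
  ... | yes (j , p) | _           = contradiction p (out j)
  ... | no _        | yes (_ , q) = cong (lookup (σ (trace Γ v u))) (v-injective (sym q))
  ... | no _        | no ¬q       = contradiction (i , refl) ¬q

  replaced-outside : ∀ u w → Outside v u → Outside v w → adj replaced u w ≡ adj Γ u w
  replaced-outside u w out-u out-w with position? v u | position? v w
  ... | yes (i , p) | _           = contradiction p (out-u i)
  ... | no _        | yes (j , q) = contradiction q (out-w j)
  ... | no _        | no _        = refl

  replaced-trace : ∀ u → Outside v u → trace replaced v u ≡ σ (trace Γ v u)
  replaced-trace u out =
    trans (tabulate-cong (replaced-across u out)) (tabulate∘lookup (σ (trace Γ v u)))

pullback : ∀ {m n} → Graph n → (Fin m → Fin n) → Graph m
pullback Γ v = record
  { adj      = λ i j → adj Γ (v i) (v j)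
  ; symm     = λ i j → symm Γ (v i) (v j)
  ; loopless = λ i → loopless Γ (v i)
  }

-- `R` and `M` are variables here, so that no concrete matrix product is unfolded.
block-exists : ∀ {m p} (G : Graph m) (R M : Matrix m m) → IsAdjacency M →
  (∀ i j → M i j ≡ (R ᵀ ⊗ (λ p q → ⟦ adj G p q ⟧) ⊗ R) i j) → Dec (p < 5) →
  ∃[ C ] (p < 5 → ∀ i j → adj C i j ≡ adj G i j) ×
         (5 ≤ p → ∀ i j → ⟦ adj C i j ⟧ ≡ (R ᵀ ⊗ (λ p q → ⟦ adj G p q ⟧) ⊗ R) i j)
block-exists G R M M-ok M≡ (yes p<5) =
  G , (λ _ _ _ → refl) , λ 5≤p → contradiction p<5 (ℕ.≤⇒≯ 5≤p)
block-exists G R M M-ok M≡ (no p≮5) =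
  proj₁ (adjacencyGraph M M-ok) , (λ p<5 → contradiction p<5 p≮5) ,
  λ _ i j → trans (proj₂ (adjacencyGraph M M-ok) i j) (M≡ i j)

module _ {n} (Γ : Graph n) (v : Fin 8 → Fin n) (k : Fin 40) (switching : IsSwitchingSet Γ v k) where
  SwitchedBlock : Graph 8 → Set
  SwitchedBlock C =
    (toℕ k < 5 → ∀ i j → adj C i j ≡ adj Γ (v i) (v j)) ×
    (5 ≤ toℕ k → ∀ i j → ⟦ adj C i j ⟧ ≡ (R-cube ᵀ ⊗ (λ p q → ⟦ adj Γ (v p) (v q) ⟧) ⊗ R-cube) i j)

  switchedBlock-exists : ∃[ C ] SwitchedBlock C
  switchedBlock-exists =
    block-exists (pullback Γ v) R-cube (switchedBlock k) (switchedBlock-adjacency k) switchedBlock≡ (toℕ k ℕ.<? 5)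
    where
    switchedBlock≡ : ∀ i j → switchedBlock k i j ≡ (R-cube ᵀ ⊗ (λ p q → ⟦ adj Γ (v p) (v q) ⟧) ⊗ R-cube) i j
    switchedBlock≡ i j = trans (congruent-product R-cube (blockMatrix k) i j)
      (congruent-cong R-cube {blockMatrix k} {λ p q → ⟦ adj Γ (v p) (v q) ⟧}
        (λ p q → cong ⟦_⟧ (sym (IsSwitchingSet.induced switching p q))) i j)

  switched-exists : Injective _≡_ _≡_ v → ∀ π → ∃[ Γ′ ] IsSwitched Γ v k π Γ′
  switched-exists v-injective π = Γ′ , record
    { rest        = replaced-outside Γ v v-injective C σ
    ; trivial     = λ u out S-trivial → trans (Γ′-trace u out) (SwitchesTo.onTrivial (σ-correct u) S-trivial)
    ; face        = λ u out S-face → trans (Γ′-trace u out) (SwitchesTo.onFace (σ-correct u) S-face)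
    ; diagonal    = λ u out S-diagonal → trans (Γ′-trace u out) (SwitchesTo.onDiagonal (σ-correct u) S-diagonal)
    ; independent = λ u out S-independent → trans (Γ′-trace u out) (SwitchesTo.onIndependent (σ-correct u) S-independent)
    ; B₁-B₅       = λ k<5 i j → trans (Γ′-block i j) (proj₁ C-switched k<5 i j)
    ; B₆-B₄₀      = λ 5≤k i j → trans (cong ⟦_⟧ (Γ′-block i j)) (proj₂ C-switched 5≤k i j)
    }
    where
    C : Graph 8
    C = proj₁ switchedBlock-exists

    C-switched : SwitchedBlock C
    C-switched = proj₂ switchedBlock-exists

    σ : Subset 8 → Subset 8
    σ = switchTrace π

    Γ′ : Graph n
    Γ′ = replaced Γ v v-injective C σ

    Γ′-trace : ∀ u → Outside v u → trace Γ′ v u ≡ σ (trace Γ v u)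
    Γ′-trace = replaced-trace Γ v v-injective C σ

    Γ′-block : ∀ i j → adj Γ′ (v i) (v j) ≡ adj C i j
    Γ′-block = replaced-inside Γ v v-injective C σ

    σ-correct : ∀ u → SwitchesTo π (trace Γ v u) (σ (trace Γ v u))
    σ-correct u = switchTrace-correct π (trace Γ v u)

-- Conjugacy makes precise that the choice of π is immaterial up to an automorphism of the cube; the
-- existence of a switched graph keeps the cospectrality claim from being vacuous.
theorem31 : (∀ (π π′ : Permutation′ 8) →
    IsCubeAutomorphism π → HasOrder π 6 →
    IsCubeAutomorphism π′ → HasOrder π′ 6 →
    ∃[ g ] IsCubeAutomorphism g × (∀ i → g ⟨$⟩ʳ (π ⟨$⟩ʳ i) ≡ π′ ⟨$⟩ʳ (g ⟨$⟩ʳ i)))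
    ×
    (∀ (n : ℕ) (Γ : Graph n) (v : Fin 8 → Fin n) → Injective _≡_ _≡_ v →
    (k : Fin 40) → IsSwitchingSet Γ v k →
    (π : Permutation′ 8) → IsCubeAutomorphism π → HasOrder π 6 →
    (5 ≤ toℕ k → RealisedByR-cube π) →
    (∃[ Γ′ ] IsSwitched Γ v k π Γ′) ×
    (∀ (Γ′ : Graph n) → IsSwitched Γ v k π Γ′ → ℝ-Cospectral Γ Γ′))
theorem31 = conjugate , λ n Γ v v-injective k switching π π-aut π-six real →
  switched-exists Γ v k switching v-injective π ,
  cospectral Γ v v-injective k switching π
    (rotation-exists sixfold rotation-acts π (sixfold-table π π-aut π-six)) real
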